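{- Let $k>1$ be an integer, and let $p$ be the smallest prime divisor of $k$. Then for every real $\alpha>\frac{1}{p-1}$ there exists $n_0=n_0(\alpha,k)\in\mathbb{N}$ such that for each $r\in\{0,1,\ldots,k-1\}$, every $\alpha$-expanding graph on at least $n_0$ vertices contains a cycle whose length is congruent to $r$ modulo $k$.
   Context: All graphs are finite and simple. For a graph $G$ and $X\subseteq V(G)$, the external neighborhood is $N_G(X):=\{v\in V(G)\setminus X : v \text{ has a neighbor in } X\}$. Given $\alpha>0$, an $n$-vertex graph $G$ is called $\alpha$-expanding (an $\alpha$-expander) if every subset $X\subseteq V(G)$ with $|X|\le n/2$ satisfies $|N_G(X)|\ge \alpha|X|$. The length of a cycle is its number of edges. -}

module Defs where

open import Data.Nat using (ℕ; zero; suc; _≤_; _*_)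
open import Data.Bool using (Bool; true; false; _∧_; _∨_; not)
open import Data.Fin using (Fin; zero; suc)
open import Data.Fin.Subset using (Subset; ∣_∣)
open import Data.Vec using (lookup; tabulate)
open import Data.List using (List; []; _∷_; length)
open import Data.List.Relation.Unary.Unique.Propositional using (Unique)
open import Data.Integer using (+_)
open import Data.Rational using (ℚ; _/_; 0ℚ) renaming (_*_ to _*ℚ_; _≤_ to _≤ℚ_)
open import Data.Product using (Σ; _×_)
open import Data.Unit using (⊤)
open import Relation.Binary.PropositionalEquality using (_≡_)

record Graph (n : ℕ) : Set where
  field
    adj      : Fin n → Fin n → Bool
    symmetric : ∀ u v → adj u v ≡ adj v u
    irreflexive : ∀ v → adj v v ≡ false
open Graph public

anyFin : ∀ {n} → (Fin n → Bool) → Bool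
anyFin {zero}  f = false
anyFin {suc n} f = f zero ∨ anyFin (λ i → f (suc i))

N[_] : ∀ {n} → Graph n → Subset n → Subset n
N[ G ] X = tabulate (λ v → not (lookup X v) ∧ anyFin (λ u → lookup X u ∧ adj G u v))

ℕ→ℚ : ℕ → ℚ
ℕ→ℚ m = (+ m) / 1

Expanding : ∀ {n} → ℚ → Graph n → Set
Expanding {n} α G = ∀ (X : Subset n) → 2 * ∣ X ∣ ≤ n → α *ℚ ℕ→ℚ ∣ X ∣ ≤ℚ ℕ→ℚ ∣ N[ G ] X ∣

-- 1/(p-1) for p ≥ 2 (the only case used: p is a prime); junk value 0 otherwise.
recipPred : ℕ → ℚ
recipPred (suc (suc q)) = (+ 1) / suc q
recipPred _ = 0ℚ

ClosedWalkFrom : ∀ {n} → Graph n → Fin n → List (Fin n) → Set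
ClosedWalkFrom G first [] = ⊤
ClosedWalkFrom G first (v ∷ []) = adj G v first ≡ true
ClosedWalkFrom G first (v ∷ w ∷ vs) = (adj G v w ≡ true) × ClosedWalkFrom G first (w ∷ vs)

IsCycleList : ∀ {n} → Graph n → List (Fin n) → Set
IsCycleList G [] = ⊤ -- excluded by the length condition below
IsCycleList G (v ∷ vs) = ClosedWalkFrom G v (v ∷ vs)

record Cycle {n} (G : Graph n) : Set where
  field
    vertices : List (Fin n)
    long     : 3 ≤ length vertices
    distinct : Unique vertices
    closed   : IsCycleList G vertices

cycleLength : ∀ {n} {G : Graph n} → Cycle G → ℕ
cycleLength C = length (Cycle.vertices C)

{-# OPTIONS --safe #-}
-- Inside an expander H one finds, from any vertex x, a small piece S of H with two routes from x
-- into what remains, of lengths l₁ and l₂; what remains still contains an expander H′, at a slightly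
-- smaller rate. Chaining such gadgets, the set F of residues attained mod k grows unless it is
-- closed under translation by l₂ − l₁. A cycle C of length L, long compared with its distance from x,
-- offers the differences L − 2i for every exit i ∈ C to the rest. If the exits had density at most
-- 1 / p, the other vertices of C would not expand, as α > 1 / (p − 1); so there are exits at
-- distance δ < p, and F is closed under 2δ. For odd p this is a unit mod k, so F is everything. For
-- p = 2 it equals 2, and since α > 1 excludes bipartite H, odd cycles provide an odd difference.
-- After at most k gadgets all residues are attained, and the chain is closed to a cycle through a
-- connected set reserved at the outset, too large to be cut off by the chain.
--
-- The argument is classical and is carried out under double negation; the existence of the
-- cycle is decidable, so the double negation can be removed at the end.
module Submission where

open import Defs
open import Data.Nat using (ℕ; zero; suc; _+_; _*_; _∸_; _≤_; _<_; z≤n; s≤s; s≤s⁻¹; parity; _≤?_; _<?_; >-nonZero; NonZero)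
import Data.Nat as Nat
open import Data.Nat.Properties
open import Data.Nat.DivMod using (_mod_; _%_; _/_; m%n<n; %-distribˡ-+; [m+kn]%n≡m%n; m<n⇒m%n≡m; m≡m%n+[m/n]*n; m/n*n≤m)
open import Data.List using (List; []; _∷_; length)
open import Data.List.Relation.Unary.All using (All; []; _∷_)
import Data.List.Relation.Unary.All as All
open import Data.List.Relation.Unary.AllPairs using ([]; _∷_)
open import Data.List.Relation.Unary.Unique.Propositional using (Unique)
open import Data.Nat.Coprimality using (Coprime; coprime-Bézout)
open import Data.Nat.GCD using (module Bézout)
open import Data.Fin using (Fin; zero; suc; toℕ; fromℕ<)
import Data.Fin.Properties as Fin
import Data.Bool.Properties as Bool
open import Data.Fin.Subset
open import Data.Fin.Subset.Properties
open import Data.Bool using (Bool; true; false; _∧_)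
open import Data.Vec using ([]; _∷_; lookup; tabulate; there)
open import Data.Vec.Properties using (lookup∘tabulate; lookup⇒[]=; []=⇒lookup)
open import Data.Product using (∃-syntax; Σ-syntax; _×_; _,_; _,′_; proj₁; proj₂)
open import Data.Sum using (_⊎_; inj₁; inj₂; [_,_]′)
open import Data.Empty using (⊥-elim)
open import Data.Nat.Tactic.RingSolver using (solve-∀)
open import Data.Parity using (Parity; 0ℙ; 1ℙ)
import Data.Parity as ℙ
import Data.Parity.Properties as ℙ
open import Data.Parity.Properties using (+-homo-+; *-homo-*)
open import Level using (Level)
open import Function using (_∘_; id; case_of_)
open import Relation.Nullary using (¬_; Dec; yes; no; does)
open import Relation.Nullary.Decidable using (dec-true; ¬¬-excluded-middle; _×-dec_; _⊎-dec_; ¬?)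
open import Relation.Nullary.Negation using () renaming (DoubleNegation to NN)
open import Relation.Binary.PropositionalEquality using (_≡_; _≢_; refl; sym; trans; cong; cong₂; subst; subst₂; module ≡-Reasoning)

-- The length L of the cycle found inside an expander cannot be controlled mod k, so a single
-- difference L - 2i may be useless. Two exits of the same cycle are compared instead: if F is
-- closed under both differences, it is closed under their difference, in which L cancels. The rate
-- is kept as e / b with `b` fixed, and every removal of a set costs one unit of e. There are k + 1
-- removals, one for the reserved set and at most k for gadgets; the strict inequality for α pays
-- for them once numerator and denominator are scaled up. The cycle must be long compared with its
-- tail, which is bounded only by the diameter, so a gadget consumes an amount linear in the
-- diameter, with coefficients depending on α and k alone. Layers of balls give a diameter of about
-- 2n / M plus a constant for any prescribed M, which keeps the total consumption a small fraction
-- of n. Throughout, expansion is tested on sets of at most half of all n vertices, even inside a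
-- subgraph. Hence each surviving expander has more than n / 2 vertices and any two of them meet,
-- which is how separately constructed pieces get connected.

private variable
  ℓ ℓ′ : Level
  n : ℕ

-- Classical reasoning under double negation.

infixl 1 _>>=_
_>>=_ : {A : Set ℓ} {B : Set ℓ′} → NN A → (A → NN B) → NN B
(m >>= f) ¬b = m (λ a → f a ¬b)

return : {A : Set ℓ} → A → NN A
return a ¬a = ¬a a

-- Double negation commutes with a universal quantifier over a finite domain, so excluded middle can
-- be assumed at all vertices at once.
decideAll : (P : Fin n → Set ℓ) → NN (∀ v → Dec (P v))
decideAll {n = zero}  P = return λ ()
decideAll {n = suc n} P = do
  d  ← ¬¬-excluded-middle
  ds ← decideAll (P ∘ suc)
  return λ { zero → d ; (suc i) → ds i }

-- Subsets of `Fin n` and their cardinalities.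

sub : {P : Fin n → Set} → (∀ v → Dec (P v)) → Subset n
sub P? = tabulate (does ∘ P?)

∈sub⁺ : {P : Fin n → Set} (P? : ∀ v → Dec (P v)) → ∀ {v} → P v → v ∈ sub P?
∈sub⁺ P? {v} pv = lookup⇒[]= v _ (trans (lookup∘tabulate (does ∘ P?) v) (dec-true (P? v) pv))

∈sub⁻ : {P : Fin n → Set} (P? : ∀ v → Dec (P v)) → ∀ {v} → v ∈ sub P? → P v
∈sub⁻ P? {v} v∈ with P? v | trans (sym (lookup∘tabulate (does ∘ P?) v)) ([]=⇒lookup v∈)
... | yes pv | _  = pv
... | no _   | ()

comprehension : (P : Fin n → Set) → NN (Σ[ X ∈ Subset n ] (∀ v → P v → v ∈ X) × (∀ v → v ∈ X → P v))
comprehension P = do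
  P? ← decideAll P
  return (sub P? , (λ v → ∈sub⁺ P?) , λ v → ∈sub⁻ P?)

x∈p─q⇒x∉q : ∀ (p q : Subset n) {x} → x ∈ p ─ q → x ∉ q
x∈p─q⇒x∉q (_ ∷ p) (inside  ∷ q) (there x∈) (there x∈q) = x∈p─q⇒x∉q p q x∈ x∈q
x∈p─q⇒x∉q (_ ∷ p) (outside ∷ q) (there x∈) (there x∈q) = x∈p─q⇒x∉q p q x∈ x∈q

x∈p-y⇒x∈p : ∀ (p : Subset n) {x y} → x ∈ p - y → x ∈ p
x∈p-y⇒x∈p p {y = y} = p─q⊆p p ⁅ y ⁆

x∈p-y⇒x≢y : ∀ (p : Subset n) {x y} → x ∈ p - y → x ≢ y
x∈p-y⇒x≢y p {y = y} x∈ refl = x∈p─q⇒x∉q p ⁅ y ⁆ x∈ (x∈⁅x⁆ y)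

-⊆- : ∀ {p q : Subset n} {x} → p ⊆ q → p - x ⊆ q - x
-⊆- {p = p} p⊆q v∈ = x∈p∧x≢y⇒x∈p-y (p⊆q (x∈p-y⇒x∈p p v∈)) (x∈p-y⇒x≢y p v∈)

∪⊆ : ∀ {p q r : Subset n} → p ⊆ r → q ⊆ r → p ∪ q ⊆ r
∪⊆ {p = p} {q} p⊆ q⊆ v∈ = [ p⊆ , q⊆ ]′ (x∈p∪q⁻ p q v∈)

⁅⁆⊆ : ∀ {r : Subset n} {u} → u ∈ r → ⁅ u ⁆ ⊆ r
⁅⁆⊆ {u = u} u∈r v∈ = subst (_∈ _) (sym (x∈⁅y⁆⇒x≡y u v∈)) u∈r

∣∪∣≤ : (p q : Subset n) → ∣ p ∪ q ∣ ≤ ∣ p ∣ + ∣ q ∣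
∣∪∣≤ [] [] = z≤n
∣∪∣≤ (outside ∷ p) (outside ∷ q) = ∣∪∣≤ p q
∣∪∣≤ (outside ∷ p) (inside  ∷ q) = ≤-trans (s≤s (∣∪∣≤ p q)) (≤-reflexive (sym (+-suc ∣ p ∣ ∣ q ∣)))
∣∪∣≤ (inside  ∷ p) (outside ∷ q) = s≤s (∣∪∣≤ p q)
∣∪∣≤ (inside  ∷ p) (inside  ∷ q) = s≤s (≤-trans (∣∪∣≤ p q) (+-monoʳ-≤ ∣ p ∣ (n≤1+n _)))

∣p∣+∣q─p∣≤∣p∪q∣ : (p q : Subset n) → ∣ p ∣ + ∣ q ─ p ∣ ≤ ∣ p ∪ q ∣
∣p∣+∣q─p∣≤∣p∪q∣ [] [] = z≤n
∣p∣+∣q─p∣≤∣p∪q∣ (outside ∷ p) (outside ∷ q) = ∣p∣+∣q─p∣≤∣p∪q∣ p q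
∣p∣+∣q─p∣≤∣p∪q∣ (outside ∷ p) (inside  ∷ q) = ≤-trans (≤-reflexive (+-suc _ _)) (s≤s (∣p∣+∣q─p∣≤∣p∪q∣ p q))
∣p∣+∣q─p∣≤∣p∪q∣ (inside  ∷ p) (_ ∷ q) = s≤s (∣p∣+∣q─p∣≤∣p∪q∣ p q)

Disjoint : Subset n → Subset n → Set
Disjoint p q = ∀ {v} → v ∈ p → v ∉ q

cover-≤ : (r p q : Subset n) → (∀ {v} → v ∈ r → v ∈ p ⊎ v ∈ q) → ∣ r ∣ ≤ ∣ p ∣ + ∣ q ∣
cover-≤ r p q f = ≤-trans (p⊆q⇒∣p∣≤∣q∣ (x∈p∪q⁺ ∘ f)) (∣∪∣≤ p q)

disjoint-≤ : (p q r : Subset n) → p ⊆ r → q ⊆ r → Disjoint p q → ∣ p ∣ + ∣ q ∣ ≤ ∣ r ∣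
disjoint-≤ p q r p⊆r q⊆r p#q =
  ≤-trans (+-monoʳ-≤ ∣ p ∣ (p⊆q⇒∣p∣≤∣q∣ λ v∈q → x∈p∧x∉q⇒x∈p─q v∈q λ v∈p → p#q v∈p v∈q))
  (≤-trans (∣p∣+∣q─p∣≤∣p∪q∣ p q) (p⊆q⇒∣p∣≤∣q∣ ([ p⊆r , q⊆r ]′ ∘ x∈p∪q⁻ p q)))

∈⇒1≤∣∣ : ∀ {p : Subset n} {v} → v ∈ p → 1 ≤ ∣ p ∣
∈⇒1≤∣∣ {v = v} v∈p = ≤-trans (≤-reflexive (sym (∣⁅x⁆∣≡1 v))) (p⊆q⇒∣p∣≤∣q∣ (⁅⁆⊆ v∈p))

1≤∣∣⇒∈ : ∀ (p : Subset n) → 1 ≤ ∣ p ∣ → Nonempty p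
1≤∣∣⇒∈ {n} p 1≤ with nonempty? p
... | yes ne = ne
... | no ¬ne with Empty-unique ¬ne
... | refl with subst (1 ≤_) (∣⊥∣≡0 n) 1≤
... | ()

∣∣≤1+∣-∣ : ∀ (p : Subset n) v → ∣ p ∣ ≤ suc ∣ p - v ∣
∣∣≤1+∣-∣ p v = ≤-trans (cover-≤ p ⁅ v ⁆ (p - v) λ {u} u∈ → case u Fin.≟ v of λ
    { (yes refl) → inj₁ (x∈⁅x⁆ v) ; (no u≢v) → inj₂ (x∈p∧x≢y⇒x∈p-y u∈ u≢v) })
  (≤-reflexive (cong (_+ ∣ p - v ∣) (∣⁅x⁆∣≡1 v)))

∣∣≡1+∣-∣ : ∀ {p : Subset n} {v} → v ∈ p → ∣ p ∣ ≡ suc ∣ p - v ∣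
∣∣≡1+∣-∣ {p = p} {v} v∈p = ≤-antisym (∣∣≤1+∣-∣ p v) (x∈p⇒∣p-x∣<∣p∣ v∈p)

∪⁅⁆-size : ∀ {p : Subset n} {v} → v ∉ p → ∣ p ∪ ⁅ v ⁆ ∣ ≡ suc ∣ p ∣
∪⁅⁆-size {p = p} {v} v∉p = ≤-antisym
  (≤-trans (∣∪∣≤ p ⁅ v ⁆) (≤-reflexive (trans (cong (∣ p ∣ +_) (∣⁅x⁆∣≡1 v)) (+-comm ∣ p ∣ 1))))
  (≤-trans (≤-reflexive (trans (+-comm 1 ∣ p ∣) (cong (∣ p ∣ +_) (sym (∣⁅x⁆∣≡1 v)))))
    (disjoint-≤ p ⁅ v ⁆ (p ∪ ⁅ v ⁆) (p⊆p∪q ⁅ v ⁆) (q⊆p∪q p ⁅ v ⁆) λ u∈p u∈v → v∉p (subst (_∈ p) (x∈⁅y⁆⇒x≡y v u∈v) u∈p)))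

x∉p⇒p-x≡p : ∀ {p : Subset n} {x} → x ∉ p → p - x ≡ p
x∉p⇒p-x≡p {p = p} {x} x∉p = ⊆-antisym (x∈p-y⇒x∈p p) λ v∈ → x∈p∧x≢y⇒x∈p-y v∈ λ { refl → x∉p v∈ }

big-meet : (p q : Subset n) → n < 2 * ∣ p ∣ → n < 2 * ∣ q ∣ → ∃[ v ] v ∈ p × v ∈ q
big-meet {n} p q np nq with nonempty? (p ∩ q)
... | yes (v , v∈) = v , x∈p∩q⁻ p q v∈
... | no ∅ = ⊥-elim (<⇒≱ lt (*-monoʳ-≤ 2 (≤-trans (disjoint-≤ p q ⊤ (λ _ → ∈⊤) (λ _ → ∈⊤) λ vp vq → ∅ (_ , x∈p∩q⁺ (vp , vq))) (≤-reflexive (∣⊤∣≡n n)))))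
  where
  lt : 2 * n < 2 * (∣ p ∣ + ∣ q ∣)
  lt = subst₂ _<_ (cong (n +_) (sym (+-identityʳ n))) (sym (*-distribˡ-+ 2 ∣ p ∣ ∣ q ∣)) (+-mono-< np nq)

subset-of-size : (p : Subset n) (m : ℕ) → m ≤ ∣ p ∣ → ∃[ q ] q ⊆ p × ∣ q ∣ ≡ m
subset-of-size {n} p zero _ = ⊥ , (λ x∈ → ⊥-elim (∉⊥ x∈)) , ∣⊥∣≡0 n
subset-of-size (outside ∷ p) (suc m) m≤ with subset-of-size p (suc m) m≤
... | q , q⊆ , eq = outside ∷ q , s⊆s q⊆ , eq
subset-of-size (inside ∷ p) (suc m) (s≤s m≤) with subset-of-size p m m≤
... | q , q⊆ , eq = inside ∷ q , s⊆s q⊆ , cong suc eq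

maximal : (P : Subset n → Set) → ∀ X₀ → P X₀ → NN (Σ[ X ∈ Subset n ] P X × (∀ Y → P Y → ∣ Y ∣ ≤ ∣ X ∣))
maximal {n} P X₀ = go n X₀ (m≤m+n n _)
  where
  -- `fuel` bounds how much `X` can still grow: every call replaces `X` by a strictly larger set.
  go : ∀ fuel X → n ≤ fuel + ∣ X ∣ → P X → NN (Σ[ X ∈ Subset n ] P X × (∀ Y → P Y → ∣ Y ∣ ≤ ∣ X ∣))
  go zero X n≤ px = return (X , px , λ Y _ → ≤-trans (∣p∣≤n Y) n≤)
  go (suc fuel) X n≤ px = do
    no ¬larger ← ¬¬-excluded-middle {A = Σ[ Y ∈ Subset n ] P Y × ∣ X ∣ < ∣ Y ∣}
      where yes (Y , py , X<Y) → go fuel Y (≤-trans n≤ (≤-trans (≤-reflexive (sym (+-suc fuel _))) (+-monoʳ-≤ fuel X<Y))) py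
    return (X , px , λ Y py → ≮⇒≥ λ X<Y → ¬larger (Y , py , X<Y))

-- Paths, walks, cycles and lollipops.

module Walks {n : ℕ} (G : Graph n) where

  private variable
    P Q R : Subset n
    u v w c : Fin n
    l i j : ℕ

  Adj : Fin n → Fin n → Set
  Adj u v = adj G u v ≡ true

  Adj? : ∀ u v → Dec (Adj u v)
  Adj? u v = adj G u v Bool.≟ true

  adj-sym : Adj u v → Adj v u
  adj-sym {u} {v} a = trans (symmetric G v u) a

  adj-irrefl : ¬ Adj u u
  adj-irrefl {u} a with trans (sym (irreflexive G u)) a
  ... | ()

  -- A simple path of length l whose l sources (all vertices but the last) lie in P.
  -- The endpoint is unconstrained, so for l ≥ 3 a Path P v v l is a cycle.
  data Path : Subset n → Fin n → Fin n → ℕ → Set where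
    []   : Path P v v 0
    step : u ∈ P → Adj u w → Path (P - u) w v l → Path P u v (suc l)

  data Walk (P : Subset n) : Fin n → Fin n → ℕ → Set where
    []   : Walk P v v 0
    step : u ∈ P → Adj u w → Walk P w v l → Walk P u v (suc l)

  weaken : P ⊆ Q → Path P u v l → Path Q u v l
  weaken P⊆Q []               = []
  weaken P⊆Q (step u∈P a p) = step (P⊆Q u∈P) a (weaken (-⊆- P⊆Q) p)

  edge : u ∈ P → Adj u v → Path P u v 1
  edge u∈P a = step u∈P a []

  append : Path P u w i → Path Q w v j → Disjoint P Q → P ⊆ R → Q ⊆ R → Path R u v (i + j)
  append [] q P#Q P⊆R Q⊆R = weaken Q⊆R q
  append {P = P} (step u∈P a p) q P#Q P⊆R Q⊆R =
    step (P⊆R u∈P) a (append p q (λ x∈ → P#Q (x∈p-y⇒x∈p P x∈)) (-⊆- P⊆R)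
      λ x∈Q → x∈p∧x≢y⇒x∈p-y (Q⊆R x∈Q) λ { refl → P#Q u∈P x∈Q })

  source∈ : Path P u v l → u ≢ v → u ∈ P
  source∈ []             u≢v = ⊥-elim (u≢v refl)
  source∈ (step u∈P _ _) _   = u∈P

  nonempty-path : Path P u v l → u ≢ v → 1 ≤ l
  nonempty-path []           u≢v = ⊥-elim (u≢v refl)
  nonempty-path (step _ _ _) _   = s≤s z≤n

  -- Only sources are recorded, so reversal exchanges the exempt endpoint: `v` becomes a source and
  -- `u` ceases to be one.
  reverse : Path P u v l → v ∉ P → Path ((P ∪ ⁅ v ⁆) - u) v u l
  reverse [] _ = []
  reverse {P = P} {u = u} {v = v} {l = suc l} (step {w = w} u∈P a p) v∉P =
    subst (Path _ v u) (+-comm l 1)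
      (append (reverse p λ v∈ → v∉P (x∈p-y⇒x∈p P v∈)) (edge (x∈⁅x⁆ w) (adj-sym a))
        (λ x∈ x∈w → x∈p-y⇒x≢y _ x∈ (x∈⁅y⁆⇒x≡y w x∈w))
        (∪⊆ (-⊆- (p⊆p∪q ⁅ v ⁆)) (⁅⁆⊆ v∈R) ∘ x∈p-y⇒x∈p _)
        (⁅⁆⊆ w∈R))
    where
    v∈R : v ∈ (P ∪ ⁅ v ⁆) - u
    v∈R = x∈p∧x≢y⇒x∈p-y (x∈p∪q⁺ (inj₂ (x∈⁅x⁆ v))) λ { refl → v∉P u∈P }
    w∈R : w ∈ (P ∪ ⁅ v ⁆) - u
    w∈R with w Fin.≟ v
    ... | yes refl = v∈R
    ... | no w≢v   = let w∈ = source∈ p w≢v in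
      x∈p∧x≢y⇒x∈p-y (x∈p∪q⁺ (inj₁ (x∈p-y⇒x∈p P w∈))) (x∈p-y⇒x≢y P w∈)

  length≤ : Path P u v l → l ≤ ∣ P ∣
  length≤ []             = z≤n
  length≤ (step u∈P _ p) = ≤-trans (s≤s (length≤ p)) (x∈p⇒∣p-x∣<∣p∣ u∈P)

  exact : Path P u v l → Σ[ S ∈ Subset n ] S ⊆ P × ∣ S ∣ ≡ l × Path S u v l
  exact [] = ⊥ , ⊥⊆ , ∣⊥∣≡0 n , []
  exact {P = P} (step {u = u} u∈P a p) with exact p
  ... | S , S⊆ , refl , p′ = S ∪ ⁅ u ⁆
      , ∪⊆ (x∈p-y⇒x∈p P ∘ S⊆) (⁅⁆⊆ u∈P)
      , ∪⁅⁆-size (λ u∈S → x∈p-y⇒x≢y P (S⊆ u∈S) refl)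
      , step (x∈p∪q⁺ (inj₂ (x∈⁅x⁆ u))) a
          (weaken (λ x∈ → x∈p∧x≢y⇒x∈p-y (x∈p∪q⁺ (inj₁ x∈)) (x∈p-y⇒x≢y P (S⊆ x∈))) p′)

  record Split (P : Subset n) (u v : Fin n) (l : ℕ) (c : Fin n) (i : ℕ) : Set where
    constructor mkSplit
    field
      {A B}  : Subset n
      {rest} : ℕ
      A⊆     : A ⊆ P
      B⊆     : B ⊆ P
      A#B    : Disjoint A B
      c∉A    : c ∉ A
      prefix : Path A u c i
      suffix : Path B c v rest
      total  : i + rest ≡ l

  split-step : u ∈ P → Adj u w → c ≢ u → Split (P - u) w v l c i → Split P u v (suc l) c (suc i)
  split-step {u = u} {P = P} u∈P a c≢u (mkSplit {A} {B} A⊆ B⊆ A#B c∉A pre suf total) = mkSplit {A = A ∪ ⁅ u ⁆} {B}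
    (∪⊆ (x∈p-y⇒x∈p P ∘ A⊆) (⁅⁆⊆ u∈P))
    (λ x∈ → x∈p-y⇒x∈p P (B⊆ x∈))
    (λ x∈ x∈B → [ (λ x∈A → A#B x∈A x∈B) , (λ x∈u → x∈p-y⇒x≢y P (B⊆ x∈B) (x∈⁅y⁆⇒x≡y u x∈u)) ]′ (x∈p∪q⁻ A ⁅ u ⁆ x∈))
    (λ c∈ → [ c∉A , c≢u ∘ x∈⁅y⁆⇒x≡y u ]′ (x∈p∪q⁻ A ⁅ u ⁆ c∈))
    (step (x∈p∪q⁺ (inj₂ (x∈⁅x⁆ u))) a (weaken (λ x∈ → x∈p∧x≢y⇒x∈p-y (x∈p∪q⁺ (inj₁ x∈)) (x∈p-y⇒x≢y P (A⊆ x∈))) pre))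
    suf
    (cong suc total)

  split-here : Path P u v l → Split P u v l u 0
  split-here p = mkSplit {A = ⊥} (⊥⊆) id (λ x∈ _ → ∉⊥ x∈) ∉⊥ [] p refl

  cut : ∀ c → Path P u v l → Path (P - c) u v l ⊎ (∃[ i ] Split P u v l c i)
  cut c [] = inj₁ []
  cut {P = P} c (step {u = u} u∈P a p) with u Fin.≟ c
  ... | yes refl = inj₂ (0 , split-here (step u∈P a p))
  ... | no u≢c with cut c p
  ...   | inj₂ (i , s) = inj₂ (suc i , split-step u∈P a (u≢c ∘ sym) s)
  ...   | inj₁ p′ = inj₁ (step (x∈p∧x≢y⇒x∈p-y u∈P u≢c) a (subst (λ X → Path X _ _ _) (p─x─y≡p─y─x P u c) p′))

  -- A path with as many sources as `P` has elements visits all of `P`: one missing `c` would fit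
  -- into `P - c`, which is too small.
  split : Path P u v l → ∣ P ∣ ≡ l → c ∈ P → ∃[ i ] Split P u v l c i
  split {c = c} p tight c∈P with cut c p
  ... | inj₂ s = s
  ... | inj₁ p′ = ⊥-elim (<⇒≱ (x∈p⇒∣p-x∣<∣p∣ c∈P) (≤-trans (≤-reflexive tight) (length≤ p′)))

  toPath : Walk P u v l → ∃[ l′ ] l′ ≤ l × Path P u v l′
  toPath [] = 0 , z≤n , []
  toPath (step {u = u} u∈P a wk) with toPath wk
  ... | l′ , l′≤ , p with cut u p
  ...   | inj₁ p′ = suc l′ , s≤s l′≤ , step u∈P a p′
  ...   | inj₂ (i , mkSplit {rest = j} _ B⊆ _ _ _ suf total) =
          j , m≤n⇒m≤1+n (≤-trans (≤-trans (m≤n+m j i) (≤-reflexive total)) l′≤) , weaken B⊆ suf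

  toWalk : Path P u v l → Walk P u v l
  toWalk = go id
    where
    go : P ⊆ Q → Path P u v l → Walk Q u v l
    go P⊆Q [] = []
    go {P = P} P⊆Q (step u∈P a p) = step (P⊆Q u∈P) a (go (λ x∈ → P⊆Q (x∈p-y⇒x∈p P x∈)) p)

  weakenʷ : P ⊆ Q → Walk P u v l → Walk Q u v l
  weakenʷ P⊆Q [] = []
  weakenʷ P⊆Q (step u∈P a wk) = step (P⊆Q u∈P) a (weakenʷ P⊆Q wk)

  appendʷ : Walk P u w i → Walk P w v j → Walk P u v (i + j)
  appendʷ []              wk′ = wk′
  appendʷ (step u∈P a wk) wk′ = step u∈P a (appendʷ wk wk′)

  reverseʷ : Walk P u v l → v ∈ P → Walk P v u l
  reverseʷ [] v∈P = []
  reverseʷ {u = u} {v = v} {l = suc l} (step {w = w} u∈P a wk) v∈P = subst (Walk _ v u) (+-comm l 1)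
    (appendʷ (reverseʷ wk v∈P) (step (start wk v∈P) (adj-sym a) []))
    where
    start : Walk P w v l → v ∈ P → w ∈ P
    start []             v∈P = v∈P
    start (step w∈P _ _) _   = w∈P

  first-hit : ∀ Q → Walk P u v l → v ∈ Q → ∃[ q ] ∃[ l′ ] q ∈ Q × l′ ≤ l × Walk (P ─ Q) u q l′
  first-hit Q [] v∈Q = _ , 0 , v∈Q , z≤n , []
  first-hit Q (step {u = u} u∈P a wk) v∈Q with u ∈? Q
  ... | yes u∈Q = u , 0 , u∈Q , z≤n , []
  ... | no u∉Q with first-hit Q wk v∈Q
  ...   | q , l′ , q∈Q , l′≤ , wk′ = q , suc l′ , q∈Q , s≤s l′≤ , step (x∈p∧x∉q⇒x∈p─q u∈P u∉Q) a wk′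

  last-leave : ∀ C → Walk P u v l → u ∈ C → v ∉ C →
    ∃[ c ] ∃[ w ] ∃[ l′ ] c ∈ C × c ∈ P × Adj c w × Walk (P ─ C) w v l′
  last-leave {P = P} C wk u∈C v∉C with go wk v∉C
    where
    go : Walk P u v l → v ∉ C →
      Walk (P ─ C) u v l ⊎ ∃[ c ] ∃[ w ] ∃[ l′ ] c ∈ C × c ∈ P × Adj c w × Walk (P ─ C) w v l′
    go [] v∉C = inj₁ []
    go (step {u = u} {w = w} u∈P a wk) v∉C with go wk v∉C | u ∈? C
    ... | inj₂ r   | _       = inj₂ r
    ... | inj₁ wk′ | yes u∈C = inj₂ (u , w , _ , u∈C , u∈P , a , wk′)
    ... | inj₁ wk′ | no u∉C  = inj₁ (step (x∈p∧x∉q⇒x∈p─q u∈P u∉C) a wk′)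
  ... | inj₂ r = r
  ... | inj₁ [] = ⊥-elim (v∉C u∈C)
  ... | inj₁ (step u∈ _ _) = ⊥-elim (x∈p─q⇒x∉q P C u∈ u∈C)

  exactʷ : Walk P u v l → Σ[ S ∈ Subset n ] S ⊆ P × ∣ S ∣ ≤ l × Walk S u v l
  exactʷ [] = ⊥ , ⊥⊆ , ≤-reflexive (∣⊥∣≡0 n) , []
  exactʷ {P = P} (step {u = u} u∈P a wk) with exactʷ wk
  ... | S , S⊆ , S≤ , wk′ = ⁅ u ⁆ ∪ S
      , ∪⊆ (⁅⁆⊆ u∈P) S⊆
      , ≤-trans (∣∪∣≤ ⁅ u ⁆ S) (+-mono-≤ (≤-reflexive (∣⁅x⁆∣≡1 u)) S≤)
      , step (x∈p∪q⁺ (inj₁ (x∈⁅x⁆ u))) a (weakenʷ (q⊆p∪q ⁅ u ⁆ S) wk′)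

  suffix-from : ∀ {X} → Path P u v l → ∣ P ∣ ≡ l → X ⊆ P → 1 ≤ ∣ X ∣ →
    ∃[ c ] ∃[ B ] ∃[ l′ ] c ∈ X × B ⊆ P × X ⊆ B × ∣ B ∣ ≡ l′ × Path B c v l′
  suffix-from [] tight X⊆ X≥ = ⊥-elim (<⇒≱ X≥ (≤-trans (p⊆q⇒∣p∣≤∣q∣ X⊆) (≤-reflexive tight)))
  suffix-from {P = P} {X = X} (step {u = u} u∈P a p) tight X⊆ X≥ with u ∈? X
  ... | yes u∈X = u , P , _ , u∈X , id , X⊆ , tight , step u∈P a p
  ... | no u∉X with suffix-from p (suc-injective (trans (sym (∣∣≡1+∣-∣ u∈P)) tight))
                     (λ x∈ → x∈p∧x≢y⇒x∈p-y (X⊆ x∈) λ { refl → u∉X x∈ }) X≥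
  ...   | c , B , l′ , c∈ , B⊆ , X⊆B , B≡ , p′ = c , B , l′ , c∈ , (x∈p-y⇒x∈p P ∘ B⊆) , X⊆B , B≡ , p′

  -- Applied after `suffix-from`, this leaves the stretch between the first and the last vertex in
  -- `X`. All of `X` except the last vertex are sources of that stretch, which gives the bound on
  -- `j`.
  prefix-to-last : ∀ {X} → Path P u v l → ∣ P ∣ ≡ l → X ⊆ P → 1 ≤ ∣ X ∣ →
    ∃[ c ] ∃[ A ] ∃[ j ] c ∈ X × A ⊆ P × c ∉ A × ∣ X ∣ ≤ suc j × Path A u c j
  prefix-to-last [] tight X⊆ X≥ = ⊥-elim (<⇒≱ X≥ (≤-trans (p⊆q⇒∣p∣≤∣q∣ X⊆) (≤-reflexive tight)))
  prefix-to-last {P = P} {X = X} (step {u = u} u∈P a p) tight X⊆ X≥ with 1 ≤? ∣ X - u ∣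
  ... | yes X-u≥ with prefix-to-last p (suc-injective (trans (sym (∣∣≡1+∣-∣ u∈P)) tight)) (-⊆- X⊆) X-u≥
  ...   | c , A , j , c∈ , A⊆ , c∉ , X≤ , p′ = c , A ∪ ⁅ u ⁆ , suc j , x∈p-y⇒x∈p X c∈
          , ∪⊆ (x∈p-y⇒x∈p P ∘ A⊆) (⁅⁆⊆ u∈P)
          , (λ c∈′ → [ c∉ , (λ c∈u → x∈p-y⇒x≢y X c∈ (x∈⁅y⁆⇒x≡y u c∈u)) ]′ (x∈p∪q⁻ A ⁅ u ⁆ c∈′))
          , ≤-trans (∣∣≤1+∣-∣ X u) (s≤s X≤)
          , step (x∈p∪q⁺ (inj₂ (x∈⁅x⁆ u))) a
              (weaken (λ x∈ → x∈p∧x≢y⇒x∈p-y (x∈p∪q⁺ (inj₁ x∈)) (x∈p-y⇒x≢y P (A⊆ x∈))) p′)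
  prefix-to-last {X = X} (step {u = u} u∈P a p) tight X⊆ X≥
      | no X-u≱ = u , ⊥ , 0 , u∈X , ⊥⊆ , ∉⊥ , ≤-trans (∣∣≤1+∣-∣ X u) (≰⇒> X-u≱) , []
    where
    u∈X : u ∈ X
    u∈X with 1≤∣∣⇒∈ X X≥
    ... | x , x∈ with x Fin.≟ u
    ...   | yes refl = x∈
    ...   | no x≢u = ⊥-elim (X-u≱ (∈⇒1≤∣∣ (x∈p∧x≢y⇒x∈p-y x∈ x≢u)))

  ClosePair : ℕ → Subset n → Subset n → Fin n → Fin n → ℕ → Set
  ClosePair p X P u v l = ∃[ c ] ∃[ c′ ] ∃[ i ] ∃[ δ ]
    c ∈ X × c′ ∈ X × 1 ≤ δ × δ < p × Split P u v l c i × Split P u v l c′ (i + δ)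

  -- Members of `X` pairwise at distance at least `p` take up `p` units of length each, except for
  -- one; the summand `p` on the right accounts for that one.
  close-pair : ∀ p {X} → Path P u v l → ∣ P ∣ ≡ l → X ⊆ P → ClosePair p X P u v l ⊎ p * ∣ X ∣ ≤ l + p
  close-pair {P} {u} {v} {l} p {X} path tight X⊆ with scan path tight X⊆
    where
    -- `h` is the position of the first member of `X`. Including it in the bound lets a new member
    -- at position 0 trade the gap `suc h`, which is at least `p`, for its own contribution `p`.
    Scan : Subset n → Subset n → Fin n → Fin n → ℕ → Set
    Scan X P u v l = ∣ X ∣ ≡ 0 ⊎ ∃[ c ] ∃[ h ] c ∈ X × Split P u v l c h × p * ∣ X ∣ + h ≤ l + p
    shift : ∀ {X P u w v l} → u ∈ P → Adj u w →
      ClosePair p (X - u) (P - u) w v l → ClosePair p X P u v (suc l)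
    shift {X} u∈ a (c , c′ , i , δ , c∈ , c′∈ , 1≤δ , δ<p , s , s′) =
      c , c′ , suc i , δ , x∈p-y⇒x∈p X c∈ , x∈p-y⇒x∈p X c′∈ , 1≤δ , δ<p , split-step u∈ a (x∈p-y⇒x≢y X c∈) s , split-step u∈ a (x∈p-y⇒x≢y X c′∈) s′
    scan : ∀ {X P u v l} → Path P u v l → ∣ P ∣ ≡ l → X ⊆ P → ClosePair p X P u v l ⊎ Scan X P u v l
    scan [] tight X⊆ = inj₂ (inj₁ (n≤0⇒n≡0 (≤-trans (p⊆q⇒∣p∣≤∣q∣ X⊆) (≤-reflexive tight))))
    scan {X} {P} {u} {v} {suc l} (step u∈P a q) tight X⊆
      with scan {X - u} q (suc-injective (trans (sym (∣∣≡1+∣-∣ u∈P)) tight)) (-⊆- X⊆) | u ∈? X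
    ... | inj₁ found | _ = inj₁ (shift {X} u∈P a found)
    ... | inj₂ (inj₁ X-u≡0) | no u∉X = inj₂ (inj₁ (trans (cong ∣_∣ (sym (x∉p⇒p-x≡p u∉X))) X-u≡0))
    ... | inj₂ (inj₁ X-u≡0) | yes u∈X = inj₂ (inj₂ (u , 0 , u∈X , split-here (step u∈P a q)
          , ≤-trans (≤-reflexive (trans (cong (λ x → p * x + 0) (trans (∣∣≡1+∣-∣ u∈X) (cong suc X-u≡0)))
              (trans (+-identityʳ _) (*-identityʳ p)))) (m≤n+m p (suc l))))
    ... | inj₂ (inj₂ (c , h , c∈ , s , bound)) | no u∉X =
          inj₂ (inj₂ (c , suc h , x∈p-y⇒x∈p X c∈ , split-step u∈P a (x∈p-y⇒x≢y X c∈) s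
          , ≤-trans (≤-reflexive (trans (+-suc _ h) (cong (λ Y → suc (p * ∣ Y ∣ + h)) (sym (x∉p⇒p-x≡p u∉X))))) (s≤s bound)))
    ... | inj₂ (inj₂ (c , h , c∈ , s , bound)) | yes u∈X with suc h <? p
    ...   | yes h<p = inj₁ (u , c , 0 , suc h , u∈X , x∈p-y⇒x∈p X c∈ , s≤s z≤n , h<p
                           , split-here (step u∈P a q) , split-step u∈P a (x∈p-y⇒x≢y X c∈) s)
    ...   | no h≮p = inj₂ (inj₂ (u , 0 , u∈X , split-here (step u∈P a q)
          , ≤-trans (≤-reflexive (trans (cong (λ x → p * x + 0) (∣∣≡1+∣-∣ u∈X)) (expand p ∣ X - u ∣)))
            (≤-trans (+-monoʳ-≤ (p * ∣ X - u ∣) (≮⇒≥ h≮p)) (≤-trans (≤-reflexive (+-suc _ h)) (s≤s bound)))))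
      where
      expand : ∀ p x → p * suc x + 0 ≡ p * x + p
      expand = solve-∀
  ... | inj₁ found = inj₁ found
  ... | inj₂ (inj₁ X≡0) = inj₂ (≤-trans (≤-reflexive (trans (cong (p *_) X≡0) (*-zeroʳ p))) z≤n)
  ... | inj₂ (inj₂ (_ , h , _ , _ , bound)) = inj₂ (≤-trans (m≤m+n _ h) bound)

  -- The two ways round a closed path from w to c, preceded by a tail T and followed by Q.
  two-ways : ∀ {T C Q U x w c z t l i r} → Path T x w t → Split C w w l c i → c ≢ w → Path Q c z r →
    Disjoint T C → Disjoint T Q → (∀ {v} → v ∈ C → v ∈ Q → v ≡ c) → T ⊆ U → C ⊆ U → Q ⊆ U →
    ∃[ j ] i + j ≡ l × Path U x z (t + (i + r)) × Path U x z (t + (j + r))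
  two-ways {T} {C} {Q} {U} {x} {w} {c} {z} tail (mkSplit {A} {B} {j} A⊆ B⊆ A#B _ pre suf total) c≢w q T#C T#Q C∩Q T⊆ C⊆ Q⊆ =
    j , total
      , append tail (append pre q (λ v∈A v∈Q → A#B v∈A (subst (_∈ B) (sym (C∩Q (A⊆ v∈A) v∈Q)) c∈B))
          (p⊆p∪q Q ∘ A⊆) (q⊆p∪q C Q)) T#CQ T⊆ (∪⊆ C⊆ Q⊆)
      , append tail (append (reverse suf w∉B) q (λ v∈ v∈Q → x∈p-y⇒x≢y _ v∈ (C∩Q (B′⊆ v∈) v∈Q))
          (p⊆p∪q Q ∘ B′⊆) (q⊆p∪q C Q)) T#CQ T⊆ (∪⊆ C⊆ Q⊆)
    where
    c∈B : c ∈ B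
    c∈B = source∈ suf c≢w
    w∈A : w ∈ A
    w∈A = source∈ pre (c≢w ∘ sym)
    w∉B : w ∉ B
    w∉B = A#B w∈A
    B′⊆ : (B ∪ ⁅ w ⁆) - c ⊆ C
    B′⊆ = ∪⊆ B⊆ (⁅⁆⊆ (A⊆ w∈A)) ∘ x∈p-y⇒x∈p _
    T#CQ : Disjoint T (C ∪ Q)
    T#CQ v∈T v∈ = [ T#C v∈T , T#Q v∈T ]′ (x∈p∪q⁻ C Q v∈)

  record Lollipop (U : Subset n) (x : Fin n) (l : ℕ) : Set where
    field
      {T C}  : Subset n
      {hub}  : Fin n
      {t}    : ℕ
      T⊆     : T ⊆ U
      C⊆     : C ⊆ U
      T#C    : Disjoint T C
      ∣C∣≡l  : ∣ C ∣ ≡ l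
      ∣T∣≡t  : ∣ T ∣ ≡ t
      tail   : Path T x hub t
      cycle  : Path C hub hub l

  cycle-at : ∀ {C c w l} → Path C c c l → ∣ C ∣ ≡ l → w ∈ C → Path C w w l
  cycle-at cyc tight w∈C with split cyc tight w∈C
  ... | i , mkSplit {rest = j} A⊆ B⊆ A#B _ pre suf total =
    subst (Path _ _ _) (trans (+-comm j i) total) (append suf pre (λ v∈B v∈A → A#B v∈A v∈B) B⊆ A⊆)

  -- Stopping at the first vertex of `C` makes the tail avoid the cycle; the cycle is then rotated
  -- to start at that vertex.
  attach-tail : ∀ {U C x c l d} → C ⊆ U → ∣ C ∣ ≡ l → Path C c c l → c ∈ C → Walk U x c d →
    Σ[ lol ∈ Lollipop U x l ] Lollipop.t lol ≤ d
  attach-tail {U} {C} C⊆ C≡ cyc c∈C wk with first-hit C wk c∈C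
  ... | w , _ , w∈C , d₁≤ , wk₁ with toPath wk₁
  ...   | _ , d₂≤ , p with exact p
  ...     | T , T⊆ , T≡ , tail = record
    { T⊆ = p─q⊆p U C ∘ T⊆ ; C⊆ = C⊆ ; T#C = x∈p─q⇒x∉q U C ∘ T⊆ ; ∣C∣≡l = C≡ ; ∣T∣≡t = T≡
    ; tail = tail ; cycle = cycle-at cyc C≡ w∈C } , ≤-trans d₂≤ d₁≤

  widen : ∀ {U V x l} → U ⊆ V → Lollipop U x l → Lollipop V x l
  widen U⊆V lol = record { Lollipop lol ; T⊆ = U⊆V ∘ Lollipop.T⊆ lol ; C⊆ = U⊆V ∘ Lollipop.C⊆ lol }

  lollipop : ∀ {U T C x w t l} → Path T x w t → Path C w w l → T ⊆ U → C ⊆ U → Disjoint T C →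
    Σ[ lol ∈ Lollipop U x l ] Lollipop.t lol ≡ t
  lollipop p c T⊆ C⊆ T#C with exact p | exact c
  ... | T′ , T′⊆ , T′≡ , p′ | C′ , C′⊆ , C′≡ , c′ = record
    { T⊆ = T⊆ ∘ T′⊆ ; C⊆ = C⊆ ∘ C′⊆ ; T#C = λ v∈T v∈C → T#C (T′⊆ v∈T) (C′⊆ v∈C)
    ; ∣C∣≡l = C′≡ ; ∣T∣≡t = T′≡ ; tail = p′ ; cycle = c′ } , refl

  stick : ∀ {U C x l} → Path C x x l → C ⊆ U → Lollipop U x l
  stick c C⊆ = proj₁ (lollipop {T = ⊥} [] c ⊥⊆ C⊆ λ v∈ _ → ∉⊥ v∈)

  parity-suc : ∀ i j → parity i ≡ parity j → parity (suc i) ≡ parity (suc j)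
  parity-suc i j eq = trans (+-homo-+ 1 i) (trans (cong (1ℙ ℙ.+_) eq) (sym (+-homo-+ 1 j)))

  drop-even : ∀ i j → parity i ≢ 1ℙ → parity (i + j) ≡ parity j
  drop-even i j even with parity i in eq
  ... | 0ℙ = trans (+-homo-+ i j) (cong (ℙ._+ parity j) eq)
  ... | 1ℙ = ⊥-elim (even refl)

  OddLollipop : Subset n → Fin n → Set
  OddLollipop U x = ∃[ l ] parity l ≡ 1ℙ × Lollipop U x l

  -- The cycle is kept up to rotation. If `u` lies on it, the tail becomes empty; if `u` lies on the
  -- tail, the tail is shortened to start there; otherwise `u` is prepended.
  extend-lollipop : ∀ {U u w} → u ∈ U → Adj u w → OddLollipop U w → OddLollipop U u
  extend-lollipop {U} {u} {w} u∈ a (l , odd , lol) = l , odd , (case (u ∈? C) ,′ (u ∈? T) of λ where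
      (yes u∈C , _) → stick (cycle-at cycle ∣C∣≡l u∈C) C⊆
      (no _ , yes u∈T) → case split tail ∣T∣≡t u∈T of λ where
        (_ , mkSplit _ B⊆ _ _ _ suf _) → proj₁ (lollipop suf cycle (T⊆ ∘ B⊆) C⊆ (T#C ∘ B⊆))
      (no u∉C , no u∉T) → proj₁ (lollipop {T = ⁅ u ⁆ ∪ T}
        (step (x∈p∪q⁺ (inj₁ (x∈⁅x⁆ u))) a
          (weaken (λ v∈ → x∈p∧x≢y⇒x∈p-y (x∈p∪q⁺ (inj₂ v∈)) λ { refl → u∉T v∈ }) tail))
        cycle (∪⊆ (⁅⁆⊆ u∈) T⊆) C⊆
        λ v∈ v∈C → [ (λ v∈u → u∉C (subst (_∈ C) (x∈⁅y⁆⇒x≡y u v∈u) v∈C)) , (λ v∈T → T#C v∈T v∈C) ]′ (x∈p∪q⁻ ⁅ u ⁆ T v∈)))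
    where open Lollipop lol

  -- Cut closed subwalks out of a walk: they are all even, or one of them gives an odd lollipop.
  lollipop-or-path : Walk P u v l → OddLollipop P u ⊎ ∃[ l′ ] parity l′ ≡ parity l × Path P u v l′
  lollipop-or-path [] = inj₂ (0 , refl , [])
  lollipop-or-path {P = P} {l = suc l} (step {u = u} u∈P a wk) = case lollipop-or-path wk of λ where
    (inj₁ lol) → inj₁ (extend-lollipop u∈P a lol)
    (inj₂ (l′ , par , p)) → case cut u p of λ where
      (inj₁ p′) → inj₂ (suc l′ , parity-suc l′ l par , step u∈P a p′)
      (inj₂ (i , mkSplit {A} {B} {j} A⊆ B⊆ A#B u∉A pre suf total)) → case parity (suc i) ℙ.≟ 1ℙ of λ where
        (yes odd) → inj₁ (suc i , odd , stick {C = ⁅ u ⁆ ∪ A} (step (x∈p∪q⁺ (inj₁ (x∈⁅x⁆ u))) a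
            (weaken (λ v∈ → x∈p∧x≢y⇒x∈p-y (x∈p∪q⁺ (inj₂ v∈)) λ { refl → u∉A v∈ }) pre)) (∪⊆ (⁅⁆⊆ u∈P) A⊆))
        (no even) → inj₂ (j , trans (sym (drop-even (suc i) j even)) (parity-suc (i + j) l (trans (cong parity total) par)) , weaken B⊆ suf)

-- Expanders: growth of balls, diameter, and what survives the removal of a small set.

-- b and e encode the expansion rate e / b; M and q only serve to bound distances.
module Expansion {n : ℕ} (G : Graph n) (b : ℕ) (1≤b : 1 ≤ b) (M q : ℕ) (n<Mq : n < M * suc q) where

  open Walks G

  private variable
    u v : Fin n
    e e′ : ℕ
    H : Subset n

  -- The subgraph induced by H expands at rate e / b; Y is any superset of the neighbourhood of X in H.
  record Exp (e : ℕ) (H : Subset n) : Set where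
    constructor mkExp
    field
      expand : ∀ X Y → X ⊆ H → (∀ u v → u ∈ X → Adj u v → v ∈ H → v ∉ X → v ∈ Y) →
        2 * ∣ X ∣ ≤ n → e * ∣ X ∣ ≤ b * ∣ Y ∣
  open Exp

  Exp-mono : e ≤ e′ → Exp e′ H → Exp e H
  Exp-mono e≤ ex = mkExp λ X Y X⊆ N⊆ X≤ → ≤-trans (*-monoˡ-≤ ∣ X ∣ e≤) (expand ex X Y X⊆ N⊆ X≤)

  private
    next? : (H X : Subset n) → ∀ v → Dec (v ∈ X ⊎ (v ∈ H × ∃[ u ] u ∈ X × Adj u v))
    next? H X v = (v ∈? X) ⊎-dec ((v ∈? H) ×-dec Fin.any? λ u → (u ∈? X) ×-dec Adj? u v)

  ball : Subset n → Fin n → ℕ → Subset n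
  ball H u zero    = ⁅ u ⁆
  ball H u (suc i) = sub (next? H (ball H u i))

  ball⊆ball : ∀ H u i → ball H u i ⊆ ball H u (suc i)
  ball⊆ball H u i v∈ = ∈sub⁺ (next? H (ball H u i)) (inj₁ v∈)

  ball⊆ : u ∈ H → ∀ i → ball H u i ⊆ H
  ball⊆ {u} {H} u∈ zero v∈ = subst (_∈ _) (sym (x∈⁅y⁆⇒x≡y u v∈)) u∈
  ball⊆ {u} {H} u∈ (suc i) v∈ with ∈sub⁻ (next? H (ball H u i)) v∈
  ... | inj₁ v∈′       = ball⊆ u∈ i v∈′
  ... | inj₂ (v∈H , _) = v∈H

  ball-walk : u ∈ H → ∀ i → v ∈ ball H u i → ∃[ l ] l ≤ i × Walk H u v l
  ball-walk {u} {H} u∈ zero v∈ with x∈⁅y⁆⇒x≡y u v∈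
  ... | refl = 0 , z≤n , []
  ball-walk {u} {H} u∈ (suc i) v∈ with ∈sub⁻ (next? H (ball H u i)) v∈
  ... | inj₁ v∈′ = let l , l≤ , wk = ball-walk u∈ i v∈′ in l , m≤n⇒m≤1+n l≤ , wk
  ... | inj₂ (_ , w , w∈ , a) with ball-walk u∈ i w∈
  ...   | l , l≤ , wk = l + 1 , ≤-trans (≤-reflexive (+-comm l 1)) (s≤s l≤)
                      , appendʷ wk (step (ball⊆ u∈ i w∈) a [])

  ball-grows : Exp e H → 1 ≤ e → u ∈ H → ∀ i → 2 * ∣ ball H u i ∣ ≤ n →
    ∃[ y ] ∣ ball H u i ∣ + y ≤ ∣ ball H u (suc i) ∣ × ∣ ball H u i ∣ ≤ b * y
  ball-grows {e} {H} {u} ex 1≤e u∈ i X≤ = ∣ Y ∣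
    , disjoint-≤ X Y X′ (ball⊆ball H u i) (p─q⊆p X′ X) (λ x∈X x∈Y → x∈p─q⇒x∉q X′ X x∈Y x∈X)
    , ≤-trans (≤-trans (≤-reflexive (sym (*-identityˡ ∣ X ∣))) (*-monoˡ-≤ ∣ X ∣ 1≤e))
        (expand ex X Y (ball⊆ u∈ i)
          (λ w v w∈ a v∈ v∉ → x∈p∧x∉q⇒x∈p─q (∈sub⁺ (next? H X) (inj₂ (v∈ , w , w∈ , a))) v∉) X≤)
    where
    X  = ball H u i
    X′ = ball H u (suc i)
    Y  = X′ ─ X

  ball-before : ∀ H u i → 2 * ∣ ball H u (suc i) ∣ ≤ n → 2 * ∣ ball H u i ∣ ≤ n
  ball-before H u i = ≤-trans (*-monoʳ-≤ 2 (p⊆q⇒∣p∣≤∣q∣ (ball⊆ball H u i)))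

  ball-linear : Exp e H → 1 ≤ e → u ∈ H → ∀ i → 2 * ∣ ball H u i ∣ ≤ n → suc i ≤ ∣ ball H u i ∣
  ball-linear {u = u} ex 1≤e u∈ zero X≤ = ≤-reflexive (sym (∣⁅x⁆∣≡1 u))
  ball-linear {H = H} {u} ex 1≤e u∈ (suc i) X≤
    with ball-linear ex 1≤e u∈ i (ball-before H u i X≤) | ball-grows ex 1≤e u∈ i (ball-before H u i X≤)
  ... | i< | zero , _ , X≤0 = ⊥-elim (<⇒≱ (≤-trans (s≤s z≤n) i<) (≤-trans X≤0 (≤-reflexive (*-zeroʳ b))))
  ... | i< | suc y , grow , _ = ≤-trans (≤-trans (≤-reflexive (+-comm 1 (suc i))) (+-mono-≤ i< (s≤s z≤n))) grow

  -- Once the ball has b * M vertices, every further layer has at least M.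
  ball-layers : Exp e H → 1 ≤ e → u ∈ H → ∀ t → 2 * ∣ ball H u (t + b * M) ∣ ≤ n → t * M ≤ ∣ ball H u (t + b * M) ∣
  ball-layers ex 1≤e u∈ zero X≤ = z≤n
  ball-layers {H = H} {u} ex 1≤e u∈ (suc t) X≤ with ball-before H u (t + b * M) X≤
  ... | X≤′ with ball-grows ex 1≤e u∈ (t + b * M) X≤′
  ...   | y , grow , X≤by = ≤-trans (≤-trans (≤-reflexive (+-comm M (t * M))) (+-mono-≤ (ball-layers ex 1≤e u∈ t X≤′) M≤y)) grow
    where
    M≤y : M ≤ y
    M≤y = *-cancelˡ-≤ b {{>-nonZero 1≤b}} (≤-trans (≤-trans (m≤n+m (b * M) t) (n≤1+n _))
      (≤-trans (ball-linear ex 1≤e u∈ (t + b * M) X≤′) X≤by))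

  -- `b * M` steps bring a ball to `b * M` vertices, and `suc q` further layers of at least `M`
  -- exceed `n`. Since `q` will be n / M, the diameter is linear in n with slope 2 / M.
  radius diameter : ℕ
  radius   = suc q + b * M
  diameter = radius + radius

  ball-big : Exp e H → 1 ≤ e → u ∈ H → n < 2 * ∣ ball H u radius ∣
  ball-big {H = H} {u} ex 1≤e u∈ = ≰⇒> λ X≤ → <⇒≱ n<Mq (≤-trans (≤-reflexive (*-comm M (suc q)))
    (≤-trans (ball-layers ex 1≤e u∈ (suc q) X≤) (≤-trans (m≤m+n _ _) X≤)))

  -- The size threshold in `Exp` refers to `n` and not to the size of `H`, so a ball in `H` cannot
  -- stop growing before it has passed n / 2.
  Exp-big : Exp e H → 1 ≤ e → u ∈ H → n < 2 * ∣ H ∣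
  Exp-big ex 1≤e u∈ = ≤-trans (ball-big ex 1≤e u∈) (*-monoʳ-≤ 2 (p⊆q⇒∣p∣≤∣q∣ (ball⊆ u∈ radius)))

  Exp-connected : Exp e H → 1 ≤ e → u ∈ H → v ∈ H → ∃[ l ] l ≤ diameter × Walk H u v l
  Exp-connected {e} {H} {u} {v} ex 1≤e u∈ v∈
    with big-meet (ball H u radius) (ball H v radius) (ball-big ex 1≤e u∈) (ball-big ex 1≤e v∈)
  ... | w , w∈u , w∈v with ball-walk u∈ radius w∈u | ball-walk v∈ radius w∈v
  ...   | l , l≤ , wk | l′ , l′≤ , wk′ = l + l′ , +-mono-≤ l≤ l′≤ , appendʷ wk (reverseʷ wk′ (ball⊆ u∈ radius w∈u))

  -- When `s` vertices are removed, the badly expanding set to be discarded has at most `b * s`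
  -- vertices, and a second such set at most `b * (s + b * s)`. `Small` keeps their union within the
  -- range where expansion applies.
  Small : ℕ → Set
  Small s = 2 * (b * s + b * (s + b * s)) ≤ n

  Small-mono : ∀ {s t} → s ≤ t → Small t → Small s
  Small-mono s≤t = ≤-trans (*-monoʳ-≤ 2 (+-mono-≤ (*-monoʳ-≤ b s≤t) (*-monoʳ-≤ b (+-mono-≤ s≤t (*-monoʳ-≤ b s≤t)))))

  Small⇒2* : ∀ {s} → Small s → 2 * (s + b * s) ≤ n
  Small⇒2* {s} = ≤-trans (*-monoʳ-≤ 2 (≤-trans (≤-trans (≤-reflexive (sym (*-identityˡ _))) (*-monoˡ-≤ (s + b * s) 1≤b))
    (m≤n+m _ (b * s))))

  -- H splits into a part Z around a large expander H′, cut off by S, and the rest.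
  record Core (e : ℕ) (H S : Subset n) : Set where
    field
      Z H′   : Subset n
      H′⊆Z   : H′ ⊆ Z
      Z⊆H    : Z ⊆ H
      Z#S    : Disjoint Z S
      exp    : Exp e H′
      centre : Fin n
      centre∈ : centre ∈ H′
      link   : ∀ z → z ∈ Z → ∃[ h ] ∃[ l ] h ∈ H′ × Walk Z z h l
      closed : ∀ v z → v ∈ H → v ∉ S → z ∈ Z → Adj v z → v ∈ Z
      small  : ∀ Y → Y ⊆ H → Disjoint Y H′ → ∣ Y ∣ ≤ ∣ S ∣ + b * ∣ S ∣

  -- One unit of rate is given up, so the set has `x` to spare, and only the `s` removed vertices
  -- can pay for it.
  cancel-excess : ∀ {e x y s} → suc e * x ≤ b * (y + s) → b * y ≤ e * x → x ≤ b * s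
  cancel-excess {e} {x} {y} {s} h k = +-cancelˡ-≤ (e * x) _ _
    (≤-trans (≤-reflexive (+-comm (e * x) x)) (≤-trans h (≤-trans (≤-reflexive (*-distribˡ-+ b y s)) (+-monoˡ-≤ (b * s) k))))

  -- Among the subsets of `H ─ S` of size at most n / 2 that do not exceed rate `e / b` there, take
  -- a largest `X` and discard it. A set `W` violating the rate in what remains could be added to
  -- `X`: the union is again bad, and still below n / 2 because `cancel-excess` bounds both parts.
  -- This contradicts maximality.
  core : Exp (suc e) H → 1 ≤ e → u ∈ H → ∀ S → Small ∣ S ∣ → NN (Core e H S)
  core {e} {H} {u} ex 1≤e u∈ S S-small = do
    X , (X⊆ , X≤ , Y , N⊆ , bY≤) , X-max ← maximal Bad ⊥ ⊥-bad
    let H′ = (H ─ S) ─ X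
        ∈H′ : ∀ {v} → v ∈ H → v ∉ S → v ∉ X → v ∈ H′
        ∈H′ = λ v∈ v∉S v∉X → x∈p∧x∉q⇒x∈p─q (x∈p∧x∉q⇒x∈p─q v∈ v∉S) v∉X
        X-small = bad⇒small (X⊆ , X≤ , Y , N⊆ , bY≤)
        small : ∀ Y → Y ⊆ H → Disjoint Y H′ → ∣ Y ∣ ≤ ∣ S ∣ + b * ∣ S ∣
        small = λ Y Y⊆ Y# → ≤-trans (cover-≤ Y S X λ {v} v∈ → case (v ∈? S) , (v ∈? X) of λ
          { (yes v∈S , _) → inj₁ v∈S ; (no _ , yes v∈X) → inj₂ v∈X
          ; (no v∉S , no v∉X) → ⊥-elim (Y# v∈ (∈H′ (Y⊆ v∈) v∉S v∉X)) }) (+-monoʳ-≤ ∣ S ∣ X-small)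
    -- `Z` takes back every discarded vertex that still reaches `H′` in `H ─ S`. Thus an edge
    -- leaving `Z` within `H` must end in `S`, and any neighbour of `Z` is a usable exit.
    Z , Z⁺ , Z⁻ ← comprehension λ v → v ∈ H ─ S × ∃[ h ] ∃[ l ] h ∈ H′ × Walk (H ─ S) v h l
    let in-Z : ∀ {v h l} → v ∈ H ─ S → h ∈ H′ → Walk (H ─ S) v h l → v ∈ Z
        in-Z = λ v∈ h∈ wk → Z⁺ _ (v∈ , _ , _ , h∈ , wk)
        centre , centre∈ = 1≤∣∣⇒∈ H′ (≰⇒> λ H′≤0 → <⇒≱ (Exp-big ex (s≤s z≤n) u∈)
          (≤-trans (*-monoʳ-≤ 2 (small H id λ _ v∈ → <⇒≱ (∈⇒1≤∣∣ v∈) H′≤0)) (Small⇒2* S-small)))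
    return record
      { Z = Z ; H′ = H′
      ; H′⊆Z = λ v∈ → in-Z (p─q⊆p (H ─ S) X v∈) v∈ []
      ; Z⊆H = λ v∈ → p─q⊆p H S (proj₁ (Z⁻ _ v∈))
      ; Z#S = λ v∈ → x∈p─q⇒x∉q H S (proj₁ (Z⁻ _ v∈))
      ; exp = H′-exp X X⊆ Y N⊆ bY≤ X-small X-max
      ; centre = centre ; centre∈ = centre∈
      ; link = λ z z∈ → let z∈HS , h , l , h∈ , wk = Z⁻ z z∈ in h , l , h∈ , lift-walk in-Z h∈ wk
      ; closed = λ v z v∈ v∉S z∈ a → let z∈HS , h , l , h∈ , wk = Z⁻ z z∈ in
          in-Z (x∈p∧x∉q⇒x∈p─q v∈ v∉S) h∈ (step (x∈p∧x∉q⇒x∈p─q v∈ v∉S) a wk)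
      ; small = small
      }
    where
    Nbhd : Subset n → Subset n → Subset n → Set
    Nbhd K X Y = ∀ u v → u ∈ X → Adj u v → v ∈ K → v ∉ X → v ∈ Y
    Bad : Subset n → Set
    Bad X = X ⊆ H ─ S × 2 * ∣ X ∣ ≤ n × ∃[ Y ] Nbhd (H ─ S) X Y × b * ∣ Y ∣ ≤ e * ∣ X ∣
    0≤ : 2 * ∣ ⊥ {n} ∣ ≤ n
    0≤ = ≤-trans (≤-reflexive (cong (2 *_) (∣⊥∣≡0 n))) z≤n
    ⊥-bad : Bad ⊥
    ⊥-bad = ⊥⊆ , 0≤ , ⊥ , (λ u v u∈ → ⊥-elim (∉⊥ u∈))
          , ≤-trans (≤-reflexive (trans (cong (b *_) (∣⊥∣≡0 n)) (*-zeroʳ b))) z≤n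
    bad⇒small : ∀ {X} → Bad X → ∣ X ∣ ≤ b * ∣ S ∣
    bad⇒small {X} (X⊆ , X≤ , Y , N⊆ , bY≤) = cancel-excess {e = e}
      (≤-trans (expand ex X (Y ∪ S) (p─q⊆p H S ∘ X⊆)
        (λ u v u∈ a v∈ v∉ → x∈p∪q⁺ (case v ∈? S of λ
          { (yes v∈S) → inj₂ v∈S ; (no v∉S) → inj₁ (N⊆ u v u∈ a (x∈p∧x∉q⇒x∈p─q v∈ v∉S) v∉) })) X≤)
        (*-monoʳ-≤ b (∣∪∣≤ Y S))) bY≤
    H′-exp : ∀ X → X ⊆ H ─ S → ∀ Y → Nbhd (H ─ S) X Y → b * ∣ Y ∣ ≤ e * ∣ X ∣ → ∣ X ∣ ≤ b * ∣ S ∣ →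
      (∀ X′ → Bad X′ → ∣ X′ ∣ ≤ ∣ X ∣) → Exp e ((H ─ S) ─ X)
    H′-exp X X⊆ Y N⊆ bY≤ X-small X-max .expand W YW W⊆ NW⊆ W≤ with e * ∣ W ∣ ≤? b * ∣ YW ∣
    ... | yes ok = ok
    -- A violating `W` turns out to be empty, and the empty set violates nothing.
    ... | no ¬ok = ⊥-elim (¬ok (≤-trans (≤-reflexive (trans (cong (e *_) W≡0) (*-zeroʳ e))) z≤n))
      where
      W⊆H : W ⊆ H
      W⊆H = p─q⊆p H S ∘ p─q⊆p (H ─ S) X ∘ W⊆
      W-small : ∣ W ∣ ≤ b * (∣ S ∣ + b * ∣ S ∣)
      W-small = ≤-trans (cancel-excess {e = e}
        (≤-trans (expand ex W (YW ∪ (S ∪ X)) W⊆H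
          (λ u v u∈ a v∈ v∉ → x∈p∪q⁺ (case (v ∈? S) , (v ∈? X) of λ
            { (yes v∈S , _) → inj₂ (x∈p∪q⁺ (inj₁ v∈S)) ; (no _ , yes v∈X) → inj₂ (x∈p∪q⁺ (inj₂ v∈X))
            ; (no v∉S , no v∉X) → inj₁ (NW⊆ u v u∈ a (x∈p∧x∉q⇒x∈p─q (x∈p∧x∉q⇒x∈p─q v∈ v∉S) v∉X) v∉) })) W≤)
          (*-monoʳ-≤ b (≤-trans (∣∪∣≤ YW (S ∪ X)) (+-monoʳ-≤ ∣ YW ∣ (∣∪∣≤ S X)))))
        (<⇒≤ (≰⇒> ¬ok))) (*-monoʳ-≤ b (+-monoʳ-≤ ∣ S ∣ X-small))
      X#W : Disjoint X W
      X#W v∈X v∈W = x∈p─q⇒x∉q (H ─ S) X (W⊆ v∈W) v∈X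
      sum≤ : ∣ X ∣ + ∣ W ∣ ≤ ∣ X ∪ W ∣
      sum≤ = disjoint-≤ X W (X ∪ W) (p⊆p∪q W) (q⊆p∪q X W) X#W
      X∪W-bad : Bad (X ∪ W)
      X∪W-bad = (λ v∈ → [ X⊆ , p─q⊆p (H ─ S) X ∘ W⊆ ]′ (x∈p∪q⁻ X W v∈))
        , ≤-trans (*-monoʳ-≤ 2 (≤-trans (∣∪∣≤ X W) (+-mono-≤ X-small W-small))) S-small
        , Y ∪ YW
        , (λ u v u∈ a v∈ v∉ → x∈p∪q⁺ (case x∈p∪q⁻ X W u∈ of λ
            { (inj₁ u∈X) → inj₁ (N⊆ u v u∈X a v∈ (λ v∈X → v∉ (x∈p∪q⁺ (inj₁ v∈X))))
            ; (inj₂ u∈W) → inj₂ (NW⊆ u v u∈W a (x∈p∧x∉q⇒x∈p─q v∈ (λ v∈X → v∉ (x∈p∪q⁺ (inj₁ v∈X))))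
                (λ v∈W → v∉ (x∈p∪q⁺ (inj₂ v∈W)))) }))
        , ≤-trans (*-monoʳ-≤ b (∣∪∣≤ Y YW)) (≤-trans (≤-reflexive (*-distribˡ-+ b ∣ Y ∣ ∣ YW ∣))
            (≤-trans (+-mono-≤ bY≤ (<⇒≤ (≰⇒> ¬ok))) (≤-trans (≤-reflexive (sym (*-distribˡ-+ e ∣ X ∣ ∣ W ∣))) (*-monoʳ-≤ e sum≤))))
      W≡0 : ∣ W ∣ ≡ 0
      W≡0 = n≤0⇒n≡0 (+-cancelˡ-≤ ∣ X ∣ _ _ (≤-trans sum≤ (≤-trans (X-max (X ∪ W) X∪W-bad) (≤-reflexive (sym (+-identityʳ _))))))
    lift-walk : ∀ {K Z H′ : Subset n} → (∀ {v h l} → v ∈ K → h ∈ H′ → Walk K v h l → v ∈ Z) →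
      ∀ {v h l} → h ∈ H′ → Walk K v h l → Walk Z v h l
    lift-walk in-Z h∈ [] = []
    lift-walk in-Z h∈ (step v∈ a wk) = step (in-Z v∈ h∈ (step v∈ a wk)) a (lift-walk in-Z h∈ wk)

  -- The vertices of C without a neighbour in Z, together with the vertices cut off by S,
  -- have all their neighbours in X ∪ (S ─ C).
  exits-bound : ∀ {S} → Exp (suc e) H → (K : Core e H S) → Small ∣ S ∣ → S ⊆ H → ∀ C X → C ⊆ S →
    (∀ c z → c ∈ C → z ∈ Core.Z K → Adj c z → c ∈ X) →
    suc e * ∣ C ∣ ≤ (suc e + b) * ∣ X ∣ + b * ∣ S ─ C ∣
  exits-bound {e} {H} {S} ex K S-small S⊆H C X C⊆S exit∈X =
    ≤-trans (*-monoʳ-≤ (suc e) (cover-≤ C X X₀ C⊆))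
    (≤-trans (≤-reflexive (*-distribˡ-+ (suc e) ∣ X ∣ ∣ X₀ ∣))
    (≤-trans (+-monoʳ-≤ (suc e * ∣ X ∣) (≤-trans X₀-exp (*-monoʳ-≤ b (∣∪∣≤ X (S ─ C)))))
    (≤-reflexive (regroup (suc e) (∣ X ∣) b (∣ S ─ C ∣)))))
    where
    open Core K
    regroup : ∀ e x b s → e * x + b * (x + s) ≡ (e + b) * x + b * s
    regroup = solve-∀
    Y = X ∪ (S ─ C)
    X₀ = (H ─ Z) ─ Y
    X₀⊆H─Z : X₀ ⊆ H ─ Z
    X₀⊆H─Z = p─q⊆p (H ─ Z) Y
    C⊆ : ∀ {v} → v ∈ C → v ∈ X ⊎ v ∈ X₀
    C⊆ {v} v∈ with v ∈? X
    ... | yes v∈X = inj₁ v∈X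
    ... | no v∉X with v ∈? Z
    ...   | no v∉Z = inj₂ (x∈p∧x∉q⇒x∈p─q (x∈p∧x∉q⇒x∈p─q (S⊆H (C⊆S v∈)) v∉Z)
                       λ v∈Y → [ v∉X , (λ v∈SC → x∈p─q⇒x∉q S C v∈SC v∈) ]′ (x∈p∪q⁻ X (S ─ C) v∈Y))
    ...   | yes v∈Z = ⊥-elim (Z#S v∈Z (C⊆S v∈))
    X₀-exp : suc e * ∣ X₀ ∣ ≤ b * ∣ Y ∣
    X₀-exp = expand ex X₀ Y (p─q⊆p H Z ∘ X₀⊆H─Z) nbhd
      (≤-trans (*-monoʳ-≤ 2 (small X₀ (p─q⊆p H Z ∘ X₀⊆H─Z) λ v∈ v∈H′ → x∈p─q⇒x∉q H Z (X₀⊆H─Z v∈) (H′⊆Z v∈H′))) (Small⇒2* S-small))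
      where
      nbhd : ∀ u v → u ∈ X₀ → Adj u v → v ∈ H → v ∉ X₀ → v ∈ Y
      nbhd u v u∈ a v∈ v∉ with v ∈? Y | v ∈? Z
      ... | yes v∈Y | _ = v∈Y
      ... | no v∉Y | no v∉Z = ⊥-elim (v∉ (x∈p∧x∉q⇒x∈p─q (x∈p∧x∉q⇒x∈p─q v∈ v∉Z) v∉Y))
      ... | no v∉Y | yes v∈Z with u ∈? C | u ∈? S
      ...   | yes u∈C | _ = ⊥-elim (x∈p─q⇒x∉q (H ─ Z) Y u∈ (x∈p∪q⁺ (inj₁ (exit∈X u v u∈C v∈Z a))))
      ...   | no u∉C | yes u∈S = ⊥-elim (x∈p─q⇒x∉q (H ─ Z) Y u∈ (x∈p∪q⁺ (inj₂ (x∈p∧x∉q⇒x∈p─q u∈S u∉C))))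
      ...   | no u∉C | no u∉S = ⊥-elim (x∈p─q⇒x∉q H Z (X₀⊆H─Z u∈) (closed u v (p─q⊆p H Z (X₀⊆H─Z u∈)) u∉S v∈Z a))

-- Gadgets from long cycles.

module Gadgets {n : ℕ} (G : Graph n) (b : ℕ) (1≤b : 1 ≤ b) (M q : ℕ) (n<Mq : n < M * suc q) where

  open Walks G
  open Expansion G b 1≤b M q n<Mq

  private variable
    u v : Fin n
    e l l₁ l₂ : ℕ
    H : Subset n

  -- Two routes from x to a vertex of H′ that consume only a small part of H.
  record Gadget (e : ℕ) (H : Subset n) (s : ℕ) (x : Fin n) (l₁ l₂ : ℕ) : Set where
    field
      H′     : Subset n
      exp    : Exp e H′
      H′⊆H   : H′ ⊆ H
      small  : ∀ Y → Y ⊆ H → Disjoint Y H′ → ∣ Y ∣ ≤ s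
      target : Fin n
      target∈ : target ∈ H′
      path₁  : Path (H ─ H′) x target l₁
      path₂  : Path (H ─ H′) x target l₂

  swap : ∀ {s x} → Gadget e H s x l₁ l₂ → Gadget e H s x l₂ l₁
  swap g = record { Gadget g ; path₁ = Gadget.path₂ g ; path₂ = Gadget.path₁ g }

  -- `Core.link` bounds no length. Stopped at its first vertex in `H′`, the path has its sources in
  -- `Z ─ H′`, and the size of that set bounds its length.
  link-short : ∀ {S} (K : Core e H S) → ∀ {z} → z ∈ Core.Z K →
    ∃[ h ] ∃[ l ] h ∈ Core.H′ K × l ≤ ∣ S ∣ + b * ∣ S ∣ × Path (Core.Z K ─ Core.H′ K) z h l
  link-short K {z} z∈ with Core.link K z z∈
  ... | h , l , h∈ , wk with first-hit (Core.H′ K) wk h∈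
  ...   | h′ , l′ , h′∈ , _ , wk′ with toPath wk′
  ...     | l″ , _ , p = h′ , l″ , h′∈
          , ≤-trans (length≤ p) (Core.small K (Core.Z K ─ Core.H′ K) (Core.Z⊆H K ∘ p─q⊆p (Core.Z K) (Core.H′ K)) (x∈p─q⇒x∉q (Core.Z K) (Core.H′ K))) , p

  Z-connected : ∀ {S} (K : Core e H S) → 1 ≤ e → ∀ {y z} → y ∈ Core.Z K → z ∈ Core.Z K →
    ∃[ l ] l ≤ (∣ S ∣ + b * ∣ S ∣) + (diameter + (∣ S ∣ + b * ∣ S ∣)) × Walk (Core.Z K) y z l
  Z-connected K 1≤e y∈ z∈ =
    let h , l , h∈ , l≤ , p = link-short K y∈
        h′ , l′ , h′∈ , l′≤ , p′ = link-short K z∈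
        r , r≤ , wk = Exp-connected (Core.exp K) 1≤e h∈ h′∈
    in l + (r + l′) , +-mono-≤ l≤ (+-mono-≤ r≤ l′≤)
     , appendʷ (weakenʷ (p─q⊆p (Core.Z K) (Core.H′ K)) (toWalk p)) (appendʷ (weakenʷ (Core.H′⊆Z K) wk)
         (reverseʷ (weakenʷ (p─q⊆p (Core.Z K) (Core.H′ K)) (toWalk p′)) (Core.H′⊆Z K h′∈)))

  -- Both routes are prolonged by the same link into `H′`, so their difference is preserved;
  -- therefore `r` is fixed before the routes are given.
  core⇒gadget : ∀ {S} (K : Core e H S) → ∀ {x z s} → z ∈ Core.Z K → ∣ S ∣ ≤ s → ∃[ r ] ∀ {l₁ l₂} →
    Path (H ─ Core.Z K) x z l₁ → Path (H ─ Core.Z K) x z l₂ → Gadget e H (s + b * s) x (l₁ + r) (l₂ + r)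
  core⇒gadget {H = H} K {x} {z} z∈ S≤s with link-short K z∈
  ... | h , r , h∈ , _ , p = r , λ p₁ p₂ → record
    { H′ = H′ ; exp = exp ; H′⊆H = Z⊆H ∘ H′⊆Z
    ; small = λ Y Y⊆ Y# → ≤-trans (small Y Y⊆ Y#) (+-mono-≤ S≤s (*-monoʳ-≤ b S≤s))
    ; target = h ; target∈ = h∈ ; path₁ = extend p₁ ; path₂ = extend p₂ }
    where
    open Core K
    extend : ∀ {l} → Path (H ─ Z) x z l → Path (H ─ H′) x h (l + r)
    extend p′ = append p′ p (λ v∈ v∈′ → x∈p─q⇒x∉q H Z v∈ (p─q⊆p Z H′ v∈′))
      (λ v∈ → x∈p∧x∉q⇒x∈p─q (p─q⊆p H Z v∈) (x∈p─q⇒x∉q H Z v∈ ∘ H′⊆Z))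
      (λ v∈ → x∈p∧x∉q⇒x∈p─q (Z⊆H (p─q⊆p Z H′ v∈)) (x∈p─q⇒x∉q Z H′ v∈))

  -- A path with j sources whose end still lies in the large part of what remains.
  record Growth (e : ℕ) (H : Subset n) (j : ℕ) : Set where
    field
      S H*  : Subset n
      start end : Fin n
      S⊆H   : S ⊆ H
      ∣S∣≡j : ∣ S ∣ ≡ j
      path  : Path S start end j
      end∈H : end ∈ H
      end∉S : end ∉ S
      H*⊆   : H* ⊆ H ─ S
      exp*  : Exp e H*
      h     : Fin n
      h∈    : h ∈ H*
      {len} : ℕ
      walk  : Walk (H ─ S) end h len

  -- `H*` and the core that remains after removing `S` and the end both exceed n / 2, hence meet. A
  -- path from the end through `H*` to a common vertex avoids `S`, and its first step extends the
  -- path while keeping the new end attached to the new core.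
  grow : Exp (suc e) H → 1 ≤ e → u ∈ H → ∀ j → Small j → NN (Growth e H j)
  grow {e} {H} {u} ex 1≤e u∈ zero _ = return record
    { S = ⊥ ; H* = H ; start = u ; end = u ; S⊆H = ⊥⊆ ; ∣S∣≡j = ∣⊥∣≡0 n ; path = [] ; end∈H = u∈ ; end∉S = ∉⊥
    ; H*⊆ = λ v∈ → x∈p∧x∉q⇒x∈p─q v∈ ∉⊥ ; exp* = Exp-mono (n≤1+n e) ex ; h = u ; h∈ = u∈ ; walk = [] }
  grow {e} {H} {u} ex 1≤e u∈ (suc j) j-small = do
    g ← grow ex 1≤e u∈ j (Small-mono (n≤1+n j) j-small)
    let open Growth g
        S⁺ = S ∪ ⁅ end ⁆
        ∣S⁺∣≡ = trans (∪⁅⁆-size end∉S) (cong suc ∣S∣≡j)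
    -- Every round takes a core of the original `H` rather than of the previous `H*`, so the rate
    -- drops by one in total and not once per vertex.
    K ← core ex 1≤e u∈ S⁺ (Small-mono (≤-reflexive ∣S⁺∣≡) j-small)
    return (next g K ∣S⁺∣≡)
    where
    next : (g : Growth e H j) → Core e H (Growth.S g ∪ ⁅ Growth.end g ⁆) →
      ∣ Growth.S g ∪ ⁅ Growth.end g ⁆ ∣ ≡ suc j → Growth e H (suc j)
    next g K ∣S⁺∣≡ =
      let h′ , h′∈H* , h′∈H′ = big-meet H* (Core.H′ K) (Exp-big exp* 1≤e h∈) (Exp-big (Core.exp K) 1≤e (Core.centre∈ K))
          _ , _ , wk = Exp-connected exp* 1≤e h∈ h′∈H*
          _ , _ , p = toPath (appendʷ walk (weakenʷ H*⊆ wk))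
      in extend h′∈H′ p
      where
      open Growth g
      S⁺ = S ∪ ⁅ end ⁆
      extend : ∀ {h′ l} → h′ ∈ Core.H′ K → Path (H ─ S) end h′ l → Growth e H (suc j)
      extend h′∈H′ [] = ⊥-elim (Core.Z#S K (Core.H′⊆Z K h′∈H′) (x∈p∪q⁺ (inj₂ (x∈⁅x⁆ _))))
      extend {h′} h′∈H′ (step {w = w} _ a p) = record
        { S = S⁺ ; H* = Core.H′ K ; start = start ; end = w
        ; S⊆H = ∪⊆ S⊆H (⁅⁆⊆ end∈H) ; ∣S∣≡j = ∣S⁺∣≡
        ; path = subst (Path S⁺ start w) (+-comm j 1)
            (append path (edge (x∈⁅x⁆ end) a) (λ v∈ v∈e → end∉S (subst (_∈ S) (x∈⁅y⁆⇒x≡y end v∈e) v∈))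
              (p⊆p∪q ⁅ end ⁆) (q⊆p∪q S ⁅ end ⁆))
        ; end∈H = proj₁ w-fresh ; end∉S = proj₂ w-fresh
        ; H*⊆ = λ v∈ → x∈p∧x∉q⇒x∈p─q (Core.Z⊆H K (Core.H′⊆Z K v∈)) (Core.Z#S K (Core.H′⊆Z K v∈))
        ; exp* = Core.exp K ; h = h′ ; h∈ = h′∈H′ ; walk = weakenʷ shrink (toWalk p) }
        where
        shrink : (H ─ S) - end ⊆ H ─ S⁺
        shrink v∈ = x∈p∧x∉q⇒x∈p─q (p─q⊆p H S (x∈p-y⇒x∈p (H ─ S) v∈)) λ v∈S⁺ →
          [ x∈p─q⇒x∉q H S (x∈p-y⇒x∈p (H ─ S) v∈) , (λ v∈e → x∈p-y⇒x≢y (H ─ S) v∈ (x∈⁅y⁆⇒x≡y end v∈e)) ]′ (x∈p∪q⁻ S ⁅ end ⁆ v∈S⁺)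
        w-fresh : w ∈ H × w ∉ S⁺
        w-fresh = case w Fin.≟ h′ of λ where
          (yes w≡h′) → subst (λ v → v ∈ H × v ∉ S⁺) (sym w≡h′)
            (Core.Z⊆H K (Core.H′⊆Z K h′∈H′) , Core.Z#S K (Core.H′⊆Z K h′∈H′))
          (no w≢h′) → let w∈ = shrink (source∈ p w≢h′) in p─q⊆p H S⁺ w∈ , x∈p─q⇒x∉q H S⁺ w∈

  private
    exit? : (C Z : Subset n) → ∀ c → Dec (c ∈ C × ∃[ z ] z ∈ Z × Adj c z)
    exit? C Z c = (c ∈? C) ×-dec Fin.any? λ z → (z ∈? Z) ×-dec Adj? c z

  exits : (C Z : Subset n) → Subset n
  exits C Z = sub (exit? C Z)

  record LongCycle (H : Subset n) (m s : ℕ) : Set where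
    field
      C     : Subset n
      c     : Fin n
      len   : ℕ
      C⊆H   : C ⊆ H
      ∣C∣≡l : ∣ C ∣ ≡ len
      m≤l   : m ≤ len
      l≤s   : len ≤ s
      cycle : Path C c c len

  -- Close a long path up through Z, from its last vertex with a neighbour in Z to its first.
  long-cycle : Exp (suc e) H → 1 ≤ e → u ∈ H → ∀ E m → suc e + b ≤ E → Small (E * suc m) →
    1 ≤ m → let s = E * suc m in NN (LongCycle H m (s + (2 + ((s + b * s) + (diameter + (s + b * s))))))
  long-cycle {e} {H} {u} ex 1≤e u∈ E m E≥ s-small 1≤m = do
    g ← grow ex 1≤e u∈ (E * suc m) s-small
    K ← core ex 1≤e u∈ (Growth.S g) (Small-mono (≤-reflexive (Growth.∣S∣≡j g)) s-small)
    return (close g K)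
    where
    close : (g : Growth e H (E * suc m)) → Core e H (Growth.S g) → let s = E * suc m in
      LongCycle H m (s + (2 + ((s + b * s) + (diameter + (s + b * s)))))
    close g K = result
      where
      open Growth g
      open Core K hiding (H′)
      X = exits S Z
      X⊆S : X ⊆ S
      X⊆S v∈ = proj₁ (∈sub⁻ (exit? S Z) v∈)
      -- With `C` equal to `S` the last term of `exits-bound` vanishes and the exits make up at
      -- least the fraction 1 / E of the path; its length is chosen to leave `suc m` of them.
      S≤ : E * suc m ≤ E * ∣ X ∣
      S≤ = ≤-trans (≤-reflexive (sym ∣S∣≡j)) (≤-trans (m≤m+n ∣ S ∣ (e * ∣ S ∣))
        (≤-trans (exits-bound ex K (Small-mono (≤-reflexive ∣S∣≡j) s-small) S⊆H S X id
          λ c z c∈ z∈ a → ∈sub⁺ (exit? S Z) (c∈ , z , z∈ , a))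
        (≤-trans (≤-reflexive (trans (cong (λ x → (suc e + b) * ∣ X ∣ + b * x) S─S)
            (trans (cong ((suc e + b) * ∣ X ∣ +_) (*-zeroʳ b)) (+-identityʳ _))))
          (*-monoˡ-≤ ∣ X ∣ E≥))))
        where
        S─S : ∣ S ─ S ∣ ≡ 0
        S─S = n≤0⇒n≡0 (≮⇒≥ λ 0< → let _ , v∈ = 1≤∣∣⇒∈ (S ─ S) 0< in x∈p─q⇒x∉q S S v∈ (p─q⊆p S S v∈))
      X≥ : suc m ≤ ∣ X ∣
      X≥ = *-cancelˡ-≤ E {{>-nonZero (≤-trans (s≤s z≤n) E≥)}} S≤
      result : LongCycle H m (E * suc m + (2 + ((E * suc m + b * (E * suc m)) + (diameter + (E * suc m + b * (E * suc m))))))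
      result =
        case suffix-from path ∣S∣≡j X⊆S (≤-trans (s≤s z≤n) X≥) of λ where
          (c , B , _ , c∈X , B⊆S , X⊆B , B≡ , p) → case prefix-to-last p B≡ X⊆B (≤-trans (s≤s z≤n) X≥) of λ where
            (c′ , A , j , c′∈X , A⊆B , c′∉A , X≤ , p′) →
              join p′ c′∉A (B⊆S ∘ A⊆B) (s≤s⁻¹ (≤-trans X≥ X≤)) (∈sub⁻ (exit? S Z) c∈X) (∈sub⁻ (exit? S Z) c′∈X)
        where
        bound : (∣ S ∣ + b * ∣ S ∣) + (diameter + (∣ S ∣ + b * ∣ S ∣)) ≤ (E * suc m + b * (E * suc m)) + (diameter + (E * suc m + b * (E * suc m)))
        bound = ≤-reflexive (cong (λ s → (s + b * s) + (diameter + (s + b * s))) ∣S∣≡j)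
        join : ∀ {c c′ A j} → Path A c c′ j → c′ ∉ A → A ⊆ S → m ≤ j →
          c ∈ S × (∃[ z ] z ∈ Z × Adj c z) → c′ ∈ S × (∃[ z ] z ∈ Z × Adj c′ z) →
          LongCycle H m (E * suc m + (2 + ((E * suc m + b * (E * suc m)) + (diameter + (E * suc m + b * (E * suc m))))))
        join {c} {c′} {A} {j} p′ c′∉A A⊆S m≤j (c∈S , z , z∈ , a) (c′∈S , z′ , z′∈ , a′) =
          case Z-connected K 1≤e z′∈ z∈ of λ where
            (r , r≤ , wk) → case toPath (appendʷ wk (step z∈ (adj-sym a) [])) of λ where
              (r′ , r′≤ , ear) → case exact (append {R = H} p′ (back ear) A#ear (S⊆H ∘ A⊆S) (∪⊆ (⁅⁆⊆ (S⊆H c′∈S)) Z⊆H)) of λ where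
                (C , C⊆H , C≡ , cyc) → record { C = C ; C⊆H = C⊆H ; ∣C∣≡l = C≡ ; m≤l = ≤-trans m≤j (m≤m+n j (suc r′))
                  ; l≤s = +-mono-≤ (≤-trans (length≤ p′) (≤-trans (p⊆q⇒∣p∣≤∣q∣ A⊆S) (≤-reflexive ∣S∣≡j)))
                      (s≤s (≤-trans r′≤ (≤-trans (≤-reflexive (+-comm r 1)) (s≤s (≤-trans r≤ bound)))))
                  ; cycle = cyc }
          where
          back : ∀ {l} → Path Z z′ c l → Path (⁅ c′ ⁆ ∪ Z) c′ c (suc l)
          back ear = step (x∈p∪q⁺ (inj₁ (x∈⁅x⁆ c′))) a′
            (weaken (λ v∈ → x∈p∧x≢y⇒x∈p-y (x∈p∪q⁺ (inj₂ v∈)) λ { refl → Z#S v∈ c′∈S }) ear)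
          A#ear : Disjoint A (⁅ c′ ⁆ ∪ Z)
          A#ear v∈A v∈ = [ (λ v∈c′ → c′∉A (subst (_∈ A) (x∈⁅y⁆⇒x≡y c′ v∈c′) v∈A))
                         , (λ v∈Z → Z#S v∈Z (A⊆S v∈A)) ]′ (x∈p∪q⁻ ⁅ c′ ⁆ Z v∈)

  -- An exit at position i of a cycle of length L gives the difference i - (L - i) = 2i - L. The
  -- equation says, without subtraction, that the differences for two exits `δ` apart differ by
  -- `2 * δ`.
  CycleStep : ℕ → ℕ → Subset n → ℕ → Fin n → Set
  CycleStep p e H s x = ∃[ l₁ ] ∃[ l₂ ] ∃[ l₁′ ] ∃[ l₂′ ] ∃[ δ ] 1 ≤ δ × δ < p ×
    Gadget e H s x l₁ l₂ × Gadget e H s x l₁′ l₂′ × l₁′ + l₂ ≡ l₂′ + l₁ + 2 * δ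

  private
    -- Multiply the exit bound by `p`. The length then has coefficient `p * f` on the left, but only
    -- `f + b` on the right if the exits are sparse. The rate makes the former larger by at least
    -- one, so the length is bounded by the remaining terms.
    density : ∀ f p l x x′ s d → b + suc f ≤ p * f → p * x′ ≤ l + p → x ≤ suc x′ →
      f * suc l ≤ (f + b) * x + b * s → s ≤ d → suc l ≤ (f + b) * (p + p) + p * (b * d)
    density f p l x x′ s d rate few x≤ bound s≤d = +-cancelˡ-≤ ((f + b) * suc l) _ _
      (≤-trans (≤-reflexive (lhs f b (suc l))) (≤-trans (*-monoˡ-≤ (suc l) rate)
      (≤-trans (≤-reflexive (*-assoc p f (suc l))) (≤-trans (*-monoʳ-≤ p bound)
      (≤-trans (≤-reflexive (mid p f b x s)) (≤-trans (+-mono-≤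
        (*-monoʳ-≤ (f + b) (≤-trans (*-monoʳ-≤ p x≤) (≤-trans (≤-reflexive (*-suc p x′))
          (≤-trans (+-monoʳ-≤ p few) (+-monoʳ-≤ p (+-monoˡ-≤ p (n≤1+n l)))))))
        (*-monoʳ-≤ p (*-monoʳ-≤ b s≤d)))
      (≤-reflexive (rhs f b p (suc l) d))))))))
      where
      lhs : ∀ f b l → (f + b) * l + l ≡ (b + suc f) * l
      lhs = solve-∀
      mid : ∀ p f b x s → p * ((f + b) * x + b * s) ≡ (f + b) * (p * x) + p * (b * s)
      mid = solve-∀
      rhs : ∀ f b p l d → (f + b) * (p + (l + p)) + p * (b * d) ≡ (f + b) * l + ((f + b) * (p + p) + p * (b * d))
      rhs = solve-∀

  -- On a long cycle the exits have density above 1 / p, so two of them are at distance δ < p.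
  cycle-step-at : Exp (suc e) H → 1 ≤ e → ∀ {x} → x ∈ H → ∀ p m s → b + suc (suc e) ≤ p * suc e →
    (suc e + b) * (p + p) + p * (b * diameter) < m → Small (s + diameter) →
    ∀ {L} → m ≤ L → L ≤ s → (lol : Lollipop H x L) → Lollipop.t lol ≤ diameter →
    NN (CycleStep p e H ((s + diameter) + b * (s + diameter)) x)
  cycle-step-at {e} {H} ex 1≤e {x} x∈ p m s rate m-large s-small {L} m≤l l≤s lol t≤ = do
    K ← core ex 1≤e x∈ (C ∪ T) (Small-mono S≤ s-small)
    return (finish K cycle)
    where
    open Lollipop lol renaming (hub to w)
    ∣T∣≤ : ∣ T ∣ ≤ diameter
    ∣T∣≤ = ≤-trans (≤-reflexive ∣T∣≡t) t≤
    S≤ : ∣ C ∪ T ∣ ≤ s + diameter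
    S≤ = ≤-trans (∣∪∣≤ C T) (+-mono-≤ (≤-trans (≤-reflexive ∣C∣≡l) l≤s) ∣T∣≤)
    finish : Core e H (C ∪ T) → Path C w w L → CycleStep p e H ((s + diameter) + b * (s + diameter)) x
    finish K [] = ⊥-elim (<⇒≱ m-large (≤-trans m≤l z≤n))
    finish K (step {l = l} w∈C a path) =
      result (close-pair p path (suc-injective (trans (sym (∣∣≡1+∣-∣ w∈C)) ∣C∣≡l)) X-w⊆)
      where
      open Core K hiding (H′)
      X = exits C Z
      -- The hub is dropped as an exit: a route once round the cycle and out at the hub would visit
      -- it twice.
      X-w⊆ : X - w ⊆ C - w
      X-w⊆ = -⊆- λ v∈ → proj₁ (∈sub⁻ (exit? C Z) v∈)
      U⊆ : C ∪ T ⊆ H ─ Z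
      U⊆ v∈ = x∈p∧x∉q⇒x∈p─q (∪⊆ C⊆ T⊆ v∈) λ v∈Z → Z#S v∈Z v∈
      short : p * ∣ X - w ∣ ≤ l + p → suc l ≤ (suc e + b) * (p + p) + p * (b * diameter)
      short few = density (suc e) p l (∣ X ∣) (∣ X - w ∣) (∣ (C ∪ T) ─ C ∣) diameter rate few (∣∣≤1+∣-∣ X w)
        (subst (λ k → suc e * k ≤ (suc e + b) * ∣ X ∣ + b * ∣ (C ∪ T) ─ C ∣) ∣C∣≡l
          (exits-bound ex K (Small-mono S≤ s-small) (∪⊆ C⊆ T⊆) C X (p⊆p∪q T)
            λ v z v∈ z∈ a′ → ∈sub⁺ (exit? C Z) (v∈ , z , z∈ , a′)))
        (≤-trans (p⊆q⇒∣p∣≤∣q∣ λ v∈ → [ (λ v∈C → ⊥-elim (x∈p─q⇒x∉q (C ∪ T) C v∈ v∈C)) , id ]′ (x∈p∪q⁻ C T (p─q⊆p (C ∪ T) C v∈)))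
          ∣T∣≤)
      gadget-at : ∀ {v i} → v ∈ X - w → Split (C - w) _ w l v i → ∃[ j ] ∃[ r ] suc i + j ≡ suc l ×
        Gadget e H ((s + diameter) + b * (s + diameter)) x (Lollipop.t lol + (suc i + 1) + r) (Lollipop.t lol + (j + 1) + r)
      gadget-at {v} {i} v∈ sp = case ∈sub⁻ (exit? C Z) (x∈p-y⇒x∈p X v∈) of λ where
        (v∈C , z , z∈ , a′) → case core⇒gadget K z∈ S≤ of λ where
          (r , mk) → case two-ways tail (split-step w∈C a (x∈p-y⇒x≢y X v∈) sp) (x∈p-y⇒x≢y X v∈) (edge (x∈⁅x⁆ v) a′) T#C
              (λ u∈T u∈v → T#C u∈T (subst (_∈ C) (sym (x∈⁅y⁆⇒x≡y v u∈v)) v∈C)) (λ _ u∈v → x∈⁅y⁆⇒x≡y v u∈v)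
              (U⊆ ∘ q⊆p∪q C T) (U⊆ ∘ p⊆p∪q T) (⁅⁆⊆ (U⊆ (p⊆p∪q T v∈C))) of λ where
            (j , total , p₁ , p₂) → j , r , total , mk p₁ p₂
      regroup : ∀ t i δ r r′ j′ → t + (suc (i + δ) + 1) + r′ + (t + (δ + j′ + 1) + r)
        ≡ t + (j′ + 1) + r′ + (t + (suc i + 1) + r) + 2 * δ
      regroup = solve-∀
      result : ClosePair p (X - w) (C - w) _ w l ⊎ p * ∣ X - w ∣ ≤ l + p →
        CycleStep p e H ((s + diameter) + b * (s + diameter)) x
      result (inj₂ few) = ⊥-elim (<⇒≱ m-large (≤-trans m≤l (short few)))
      result (inj₁ (c , c′ , i , δ , c∈ , c′∈ , 1≤δ , δ<p , sp , sp′)) = case gadget-at c∈ sp ,′ gadget-at c′∈ sp′ of λ where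
        ((j , r , total , g) , (j′ , r′ , total′ , g′)) →
          let j≡ : j ≡ δ + j′
              j≡ = +-cancelˡ-≡ (suc i) _ _ (trans total (trans (sym total′) (+-assoc (suc i) δ j′)))
          in _ , _ , _ , _ , δ , 1≤δ , δ<p , g , g′
            , trans (cong (λ j → t + (suc (i + δ) + 1) + r′ + (t + (j + 1) + r)) j≡) (regroup t i δ r r′ j′)

  cycle-step : Exp (suc e) H → 1 ≤ e → ∀ {x} → x ∈ H → ∀ p m s → b + suc (suc e) ≤ p * suc e →
    (suc e + b) * (p + p) + p * (b * diameter) < m → Small (s + diameter) → LongCycle H m s →
    NN (CycleStep p e H ((s + diameter) + b * (s + diameter)) x)
  cycle-step ex 1≤e x∈ p m s rate m-large s-small long =
    case 1≤∣∣⇒∈ C (≤-trans (s≤s z≤n) (≤-trans m-large (≤-trans m≤l (≤-reflexive (sym ∣C∣≡l))))) of λ where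
      (c , c∈) → case Exp-connected ex (s≤s z≤n) x∈ (C⊆H c∈) of λ where
        (_ , d≤ , wk) → case attach-tail C⊆H ∣C∣≡l (cycle-at cycle ∣C∣≡l c∈) c∈ wk of λ where
          (lol , t≤) → cycle-step-at ex 1≤e x∈ p m s rate m-large s-small m≤l l≤s lol (≤-trans t≤ d≤)
    where open LongCycle long using (C; C⊆H; ∣C∣≡l; m≤l; l≤s; cycle)

-- Expansion above 1: odd cycles and gadgets of odd difference.

module Parities {n : ℕ} (G : Graph n) (b : ℕ) (1≤b : 1 ≤ b) (M q : ℕ) (n<Mq : n < M * suc q) where

  open Walks G
  open Expansion G b 1≤b M q n<Mq
  open Exp
  open Gadgets G b 1≤b M q n<Mq

  private variable
    u v : Fin n
    e l l₁ l₂ : ℕ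
    H : Subset n

  -- Sums stand in for differences, having the same parity; a common prolongation of both routes
  -- does not change it.
  odd-shift : ∀ i j a → parity (i + j) ≡ 1ℙ → parity ((i + a) + (j + a)) ≡ 1ℙ
  odd-shift i j a odd = trans (cong parity (regroup i j a)) (trans (drop-even (2 * a) (i + j) twice) odd)
    where
    regroup : ∀ i j a → (i + a) + (j + a) ≡ 2 * a + (i + j)
    regroup = solve-∀
    twice : parity (2 * a) ≢ 1ℙ
    twice eq = case trans (sym eq) (*-homo-* 2 a) of λ ()

  one-odd : ∀ i j → parity (i + j) ≡ 1ℙ → parity i ≡ 1ℙ ⊎ parity j ≡ 1ℙ
  one-odd i j odd with parity i in eq
  ... | 1ℙ = inj₁ refl
  ... | 0ℙ = inj₂ (trans (sym (cong (ℙ._+ parity j) eq)) (trans (sym (+-homo-+ i j)) odd))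

  -- When e > b no H is bipartite: a subset of the larger class as big as the smaller one would not expand.
  ¬bipartite : Exp (suc e) H → b ≤ e → 2 ≤ n → u ∈ H → (A B : Subset n) → A ⊆ H → B ⊆ H → Disjoint A B →
    (∀ v → v ∈ H → v ∉ A → v ∈ B) → (∀ v w → v ∈ A → w ∈ A → ¬ Adj v w) → ¬ ∣ B ∣ ≤ ∣ A ∣
  ¬bipartite {e} {H} {u} ex b≤e 2≤n u∈ A B A⊆ B⊆ A#B rest indep B≤A with ∣ B ∣ in B≡
  -- With `B` empty all of `H` is independent, and the single vertex `u` has no neighbour in it.
  ... | zero = <⇒≱ (s≤s z≤n) (≤-trans (≤-trans (≤-reflexive (sym (trans (cong (suc e *_) (∣⁅x⁆∣≡1 u)) (*-identityʳ (suc e)))))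
        (expand ex ⁅ u ⁆ B (⁅⁆⊆ u∈) nbhd (≤-trans (≤-reflexive (cong (2 *_) (∣⁅x⁆∣≡1 u))) 2≤n)))
        (≤-reflexive (trans (cong (b *_) B≡) (*-zeroʳ b))))
    where
    in-A : v ∈ H → v ∈ A
    in-A {v} v∈ with v ∈? A
    ... | yes v∈A = v∈A
    ... | no v∉A  = ⊥-elim (<⇒≱ (∈⇒1≤∣∣ (rest v v∈ v∉A)) (≤-reflexive B≡))
    nbhd : ∀ v w → v ∈ ⁅ u ⁆ → Adj v w → w ∈ H → w ∉ ⁅ u ⁆ → w ∈ B
    nbhd v w v∈ a w∈ _ = ⊥-elim (indep v w (subst (_∈ A) (sym (x∈⁅y⁆⇒x≡y u v∈)) (in-A u∈)) (in-A w∈) a)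
  ... | suc β with subset-of-size A (suc β) B≤A
  ...   | X , X⊆A , X≡ = <⇒≱ (s≤s b≤e) (*-cancelʳ-≤ (suc e) b (suc β)
          (≤-trans (≤-reflexive (cong (suc e *_) (sym X≡)))
          (≤-trans (expand ex X B (A⊆ ∘ X⊆A) nbhd half) (≤-reflexive (cong (b *_) B≡)))))
    where
    nbhd : ∀ v w → v ∈ X → Adj v w → w ∈ H → w ∉ X → w ∈ B
    nbhd v w v∈ a w∈ _ = rest w w∈ λ w∈A → indep v w (X⊆A v∈) w∈A a
    half : 2 * ∣ X ∣ ≤ n
    half = ≤-trans (≤-reflexive (trans (cong (λ x → x + (x + 0)) X≡) (cong (suc β +_) (+-identityʳ _))))
      (≤-trans (+-mono-≤ B≤A (≤-reflexive (sym B≡)))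
      (≤-trans (disjoint-≤ A B ⊤ (λ _ → ∈⊤) (λ _ → ∈⊤) A#B) (≤-reflexive (∣⊤∣≡n n))))

  -- Take the vertices reached from `x` by an even walk of length at most the diameter; each of the
  -- others is reached by an odd one. An edge inside either class would close an odd walk, so
  -- without such a walk the classes form a bipartition.
  odd-closed-walk : Exp (suc e) H → b ≤ e → 2 ≤ n → ∀ {x} → x ∈ H →
    NN (∃[ l ] l ≤ suc (diameter + diameter) × parity l ≡ 1ℙ × Walk H x x l)
  odd-closed-walk {e} {H} ex b≤e 2≤n {x} x∈ = do
    no none ← ¬¬-excluded-middle {A = OddWalk}
      where yes w → return w
    A , A⁺ , A⁻ ← comprehension (Reach 0ℙ)
    let B = H ─ A
        A⊆ : A ⊆ H
        A⊆ = λ v∈ → proj₁ (A⁻ _ v∈)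
        B-odd : ∀ v → v ∈ B → Reach 1ℙ v
        B-odd = λ v v∈ → odd-side (A⁺ v) (p─q⊆p H A v∈) (x∈p─q⇒x∉q H A v∈)
        A-indep : ∀ v w → v ∈ A → w ∈ A → ¬ Adj v w
        A-indep = λ v w v∈ w∈ a → none (close (A⁻ v v∈) (A⁻ w w∈) a)
        B-indep : ∀ v w → v ∈ B → w ∈ B → ¬ Adj v w
        B-indep = λ v w v∈ w∈ a → none (close (B-odd v v∈) (B-odd w w∈) a)
    ⊥-elim ([ ¬bipartite ex b≤e 2≤n x∈ A B A⊆ (p─q⊆p H A) (λ v∈A v∈B → x∈p─q⇒x∉q H A v∈B v∈A)
                (λ v v∈ v∉A → x∈p∧x∉q⇒x∈p─q v∈ v∉A) A-indep
            , ¬bipartite ex b≤e 2≤n x∈ B A (p─q⊆p H A) A⊆ (x∈p─q⇒x∉q H A)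
                (λ v v∈ v∉B → not-B v∈ v∉B) B-indep ]′ (≤-total ∣ B ∣ ∣ A ∣))
    where
    OddWalk : Set
    OddWalk = ∃[ l ] l ≤ suc (diameter + diameter) × parity l ≡ 1ℙ × Walk H x x l
    Reach : Parity → Fin n → Set
    Reach c v = v ∈ H × ∃[ l ] l ≤ diameter × parity l ≡ c × Walk H x v l
    odd-side : ∀ {v} {A : Set} → (Reach 0ℙ v → A) → v ∈ H → ¬ A → Reach 1ℙ v
    odd-side {v} A⁺ v∈ v∉A = case Exp-connected ex (s≤s z≤n) x∈ v∈ of λ where
        (l , l≤ , wk) → case parity l ℙ.≟ 1ℙ of λ where
          (yes odd) → v∈ , l , l≤ , odd , wk
          (no ¬odd) → ⊥-elim (v∉A (A⁺ (v∈ , l , l≤ , even l ¬odd , wk)))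
      where
      even : ∀ l → parity l ≢ 1ℙ → parity l ≡ 0ℙ
      even l ¬odd with parity l
      ... | 0ℙ = refl
      ... | 1ℙ = ⊥-elim (¬odd refl)
    not-B : ∀ {A v} → v ∈ H → v ∉ H ─ A → v ∈ A
    not-B {A} {v} v∈ v∉ with v ∈? A
    ... | yes v∈A = v∈A
    ... | no v∉A  = ⊥-elim (v∉ (x∈p∧x∉q⇒x∈p─q v∈ v∉A))
    close : ∀ {c v w} → Reach c v → Reach c w → Adj v w → OddWalk
    close {c} (v∈ , l , l≤ , pl , wk) (w∈ , l′ , l′≤ , pl′ , wk′) a = l + suc l′
      , ≤-trans (≤-reflexive (+-suc l l′)) (s≤s (+-mono-≤ l≤ l′≤))
      , trans (cong parity (+-suc l l′)) (trans (+-homo-+ 1 (l + l′)) (cong (1ℙ ℙ.+_)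
          (trans (+-homo-+ l l′) (trans (cong₂ ℙ._+_ pl pl′) (ℙ.p+p≡0ℙ c)))))
      , appendʷ wk (step v∈ a (reverseʷ wk′ w∈))

  OddPair : Subset n → Subset n → Fin n → Set
  OddPair H Z x = ∃[ z ] ∃[ l₁ ] ∃[ l₂ ] z ∈ Z × parity (l₁ + l₂) ≡ 1ℙ × Path (H ─ Z) x z l₁ × Path (H ─ Z) x z l₂

  -- A path avoiding the hub leads from an odd cycle either to Z, where we are done, or back
  -- to the tail, where one of the two ways round gives an odd lollipop with a shorter tail.
  shrink-tail : ∀ {S x} (K : Core e H S) → Exp (suc e) H → 1 ≤ e → b ≤ e → ∀ fuel → (ol : OddLollipop (H ─ Core.Z K) x) →
    Lollipop.t (proj₂ (proj₂ ol)) < fuel → NN (OddPair H (Core.Z K) x)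
  shrink-tail {e} {H} {S} {x} K ex 1≤e b≤e (suc fuel) (L , odd , lol) (s≤s t≤) = round cycle
    where
    open Core K
    open Lollipop lol renaming (hub to w)
    Z∪T = Z ∪ T
    round : Path C w w L → NN (OddPair H Z x)
    round [] = case odd of λ ()
    round (step {w = c₁} w∈C a p) = do
      X , X⁺ , X⁻ ← comprehension λ v → v ∈ H × v ≢ w × ∃[ l ] Walk (H - w) c₁ v l
      escape (reach-Z X X⁺ X⁻)
      where
      c₁≢w : c₁ ≢ w
      c₁≢w c₁≡w = adj-irrefl (subst (Adj w) c₁≡w a)
      c₁∈C : c₁ ∈ C
      c₁∈C = x∈p-y⇒x∈p C (source∈ p c₁≢w)
      reach-Z : ∀ X → (∀ v → v ∈ H × v ≢ w × (∃[ l ] Walk (H - w) c₁ v l) → v ∈ X) →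
        (∀ v → v ∈ X → v ∈ H × v ≢ w × ∃[ l ] Walk (H - w) c₁ v l) → ∃[ h ] ∃[ l ] h ∈ H′ × Walk (H - w) c₁ h l
      reach-Z X X⁺ X⁻ = case big-meet X H′ X-big (Exp-big exp 1≤e centre∈) of λ where
          (h , h∈X , h∈H′) → case X⁻ h h∈X of λ where
            (_ , _ , l , wk) → h , l , h∈H′ , wk
        where
        nbhd : ∀ u v → u ∈ X → Adj u v → v ∈ H → v ∉ X → v ∈ ⁅ w ⁆
        nbhd u v u∈ a′ v∈ v∉ = case v Fin.≟ w of λ where
          (yes refl) → x∈⁅x⁆ w
          (no v≢w) → case X⁻ u u∈ of λ where
            (u∈H , u≢w , l , wk) → ⊥-elim (v∉ (X⁺ v (v∈ , v≢w , l + 1 , appendʷ wk (step (x∈p∧x≢y⇒x∈p-y u∈H u≢w) a′ []))))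
        -- The only possible neighbour of `X` in `H` outside `X` is `w`, and as `b ≤ e` a nonempty
        -- set of at most n / 2 vertices has more than one.
        X-big : n < 2 * ∣ X ∣
        X-big = ≰⇒> λ X≤ → <⇒≱ (s≤s b≤e) (≤-trans (≤-trans (≤-reflexive (sym (*-identityʳ (suc e))))
          (*-monoʳ-≤ (suc e) (∈⇒1≤∣∣ (X⁺ c₁ (p─q⊆p H Z (C⊆ c₁∈C) , c₁≢w , 0 , [])))))
          (≤-trans (expand ex X ⁅ w ⁆ (λ v∈ → proj₁ (X⁻ _ v∈)) nbhd X≤)
            (≤-reflexive (trans (cong (b *_) (∣⁅x⁆∣≡1 w)) (*-identityʳ b)))))
      escape : ∃[ h ] ∃[ l ] h ∈ H′ × Walk (H - w) c₁ h l → NN (OddPair H Z x)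
      escape (h , l , h∈ , wk) = case first-hit Z∪T wk (x∈p∪q⁺ (inj₁ (H′⊆Z h∈))) of λ where
          (q , _ , q∈ , _ , wk′) → case last-leave C wk′ c₁∈C (q∉C q∈) of λ where
            (c , w′ , _ , c∈C , c∈ , a′ , wk″) → case toPath wk″ ,′ split cycle ∣C∣≡l c∈C of λ where
              ((r , _ , path) , (i , sp)) → arrive c∈C (x∈p-y⇒x≢y H (p─q⊆p (H - w) Z∪T c∈)) (p─q⊆p H Z (C⊆ c∈C)) sp
                (step {P = ⁅ c ⁆ ∪ (((H - w) ─ Z∪T) ─ C)} (x∈p∪q⁺ (inj₁ (x∈⁅x⁆ c))) a′
                  (weaken (λ v∈ → x∈p∧x≢y⇒x∈p-y (x∈p∪q⁺ (inj₂ v∈)) λ { refl → x∈p─q⇒x∉q _ C v∈ c∈C }) path))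
                (x∈p∪q⁻ Z T q∈)
        where
        q∉C : ∀ {q} → q ∈ Z∪T → q ∉ C
        q∉C q∈ q∈C = [ x∈p─q⇒x∉q H Z (C⊆ q∈C) , (λ q∈T → T#C q∈T q∈C) ]′ (x∈p∪q⁻ Z T q∈)
        arrive : ∀ {c q i r} → c ∈ C → c ≢ w → c ∈ H → Split C w w L c i →
          Path (⁅ c ⁆ ∪ (((H - w) ─ Z∪T) ─ C)) c q r → q ∈ Z ⊎ q ∈ T → NN (OddPair H Z x)
        arrive {c} {q} {i} {r} c∈C c≢w c∈H sp path q∈ = [ at-Z , at-T ]′ q∈
          where
          P = ((H - w) ─ Z∪T) ─ C
          Q = ⁅ c ⁆ ∪ P
          T#Q : Disjoint T Q
          T#Q v∈T v∈Q = [ (λ v∈c → T#C v∈T (⁅⁆⊆ c∈C v∈c))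
            , (λ v∈P → x∈p─q⇒x∉q (H - w) Z∪T (p─q⊆p _ C v∈P) (x∈p∪q⁺ (inj₂ v∈T))) ]′ (x∈p∪q⁻ ⁅ c ⁆ P v∈Q)
          C∩Q : ∀ {v} → v ∈ C → v ∈ Q → v ≡ c
          C∩Q v∈C v∈Q = [ x∈⁅y⁆⇒x≡y c , (λ v∈P → ⊥-elim (x∈p─q⇒x∉q _ C v∈P v∈C)) ]′ (x∈p∪q⁻ ⁅ c ⁆ P v∈Q)
          Q⊆ : Q ⊆ H ─ Z
          Q⊆ = ∪⊆ (⁅⁆⊆ (C⊆ c∈C)) λ v∈P → x∈p∧x∉q⇒x∈p─q (x∈p-y⇒x∈p H (p─q⊆p _ Z∪T (p─q⊆p _ C v∈P)))
            λ v∈Z → x∈p─q⇒x∉q (H - w) Z∪T (p─q⊆p _ C v∈P) (x∈p∪q⁺ (inj₁ v∈Z))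
          two-odd : ∀ {t i j r} → i + j ≡ L → parity ((t + (i + r)) + (t + (j + r))) ≡ 1ℙ
          two-odd {t} {i} {j} {r} total = trans (cong parity (cong₂ _+_ (regroup t i r) (regroup t j r)))
            (odd-shift i j (t + r) (trans (cong parity total) odd))
            where
            regroup : ∀ t i r → t + (i + r) ≡ i + (t + r)
            regroup = solve-∀
          at-Z : q ∈ Z → NN (OddPair H Z x)
          at-Z q∈Z = case two-ways tail sp c≢w path T#C T#Q C∩Q T⊆ C⊆ Q⊆ of λ where
            (j , total , p₁ , p₂) → return (q , _ , _ , q∈Z , two-odd {t} {i} {j} {r} total , p₁ , p₂)
          at-T : q ∈ T → NN (OddPair H Z x)
          at-T q∈T = case split tail ∣T∣≡t q∈T of λ where
            (k , mkSplit {A} {B} {rest} A⊆ B⊆ A#B _ pre suf total) →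
              -- The new cycle starts at `q`, follows the rest of the tail to `w`, goes round `C` to
              -- `c` by one of the two ways, and returns to `q`, which becomes the hub.
              case two-ways {U = B ∪ (C ∪ Q)} suf sp c≢w path (T#C ∘ B⊆) (T#Q ∘ B⊆) C∩Q (p⊆p∪q (C ∪ Q))
                (q⊆p∪q B (C ∪ Q) ∘ p⊆p∪q Q) (q⊆p∪q B (C ∪ Q) ∘ q⊆p∪q C Q) of λ where
                (j , total′ , p₁ , p₂) →
                  let k<t : k < t
                      k<t = ≤-trans (≤-trans (≤-reflexive (+-comm 1 k))
                        (+-monoʳ-≤ k (nonempty-path suf λ { refl → T#C q∈T w∈C }))) (≤-reflexive total)
                      again : ∀ {l} → parity l ≡ 1ℙ → Path (B ∪ (C ∪ Q)) q q l → NN (OddPair H Z x)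
                      again {l} odd′ p = case lollipop pre p (T⊆ ∘ A⊆) (∪⊆ (T⊆ ∘ B⊆) (∪⊆ C⊆ Q⊆))
                          (λ v∈A v∈ → [ A#B v∈A , (λ v∈CQ → [ T#C (A⊆ v∈A) , T#Q (A⊆ v∈A) ]′ (x∈p∪q⁻ C Q v∈CQ)) ]′
                            (x∈p∪q⁻ B (C ∪ Q) v∈)) of λ where
                        (lol′ , t≡) → shrink-tail K ex 1≤e b≤e fuel (l , odd′ , lol′)
                          (≤-trans (s≤s (≤-reflexive t≡)) (≤-trans k<t t≤))
                  in [ (λ o → again {rest + (i + r)} o p₁) , (λ o → again {rest + (j + r)} o p₂) ]′ 
                    (one-odd (rest + (i + r)) (rest + (j + r)) (two-odd {rest} {i} {j} {r} total′))

  parity-step : Exp (suc e) H → 1 ≤ e → b ≤ e → 2 ≤ n → ∀ {x} → x ∈ H → ∀ s → suc (diameter + diameter) ≤ s → Small s →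
    NN (∃[ l₁ ] ∃[ l₂ ] parity (l₁ + l₂) ≡ 1ℙ × Gadget e H (s + b * s) x l₁ l₂)
  parity-step {e} {H} ex 1≤e b≤e 2≤n {x} x∈ s d≤ s-small = do
    l , l≤ , odd , wk ← odd-closed-walk ex b≤e 2≤n x∈
    let S , S⊆ , S≤ , wk′ = exactʷ wk
        S≤s = ≤-trans S≤ (≤-trans l≤ d≤)
    K ← core ex 1≤e x∈ S (Small-mono S≤s s-small)
    let ol = odd-lollipop l (lollipop-or-path wk′) odd
        S⊆HZ : S ⊆ H ─ Core.Z K
        S⊆HZ = λ v∈ → x∈p∧x∉q⇒x∈p─q (S⊆ v∈) λ v∈Z → Core.Z#S K v∈Z v∈
    z , l₁ , l₂ , z∈ , odd′ , p₁ , p₂ ← shrink-tail K ex 1≤e b≤e _ (proj₁ ol , proj₁ (proj₂ ol) , widen S⊆HZ (proj₂ (proj₂ ol))) ≤-refl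
    let r , mk = core⇒gadget K z∈ S≤s
    return (l₁ + r , l₂ + r , odd-shift l₁ l₂ r odd′ , mk p₁ p₂)
    where
    odd-lollipop : ∀ {S} l → OddLollipop S x ⊎ (∃[ l′ ] parity l′ ≡ parity l × Path S x x l′) → parity l ≡ 1ℙ → OddLollipop S x
    odd-lollipop l (inj₁ ol) odd = ol
    odd-lollipop l (inj₂ (l′ , par , p)) odd = l′ , trans par odd , stick p id

-- Sets of residues mod k closed under translations.

module Residues (k′ : ℕ) where

  private
    k : ℕ
    k = suc k′

  infix 4 _≈_
  _≈_ : ℕ → ℕ → Set
  x ≈ y = x % k ≡ y % k

  +-cong-≈ : ∀ {x y} z → x ≈ y → x + z ≈ y + z
  +-cong-≈ {x} {y} z eq = trans (%-distribˡ-+ x z k) (trans (cong (λ r → (r + z % k) % k) eq) (sym (%-distribˡ-+ y z k)))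

  drop-multiple : ∀ x j → x + j * k ≈ x
  drop-multiple x j = [m+kn]%n≡m%n x j k

  ρ : ℕ → Fin k
  ρ x = x mod k

  toℕ-ρ : ∀ x → toℕ (ρ x) ≡ x % k
  toℕ-ρ x = Fin.toℕ-fromℕ< (m%n<n x k)

  ρ-cong : ∀ {x y} → x ≈ y → ρ x ≡ ρ y
  ρ-cong {x} {y} eq = Fin.toℕ-injective (trans (toℕ-ρ x) (trans eq (sym (toℕ-ρ y))))

  ρ-injective : ∀ {x y} → ρ x ≡ ρ y → x ≈ y
  ρ-injective {x} {y} eq = trans (sym (toℕ-ρ x)) (trans (cong toℕ eq) (toℕ-ρ y))

  Closed : Subset k → ℕ → Set
  Closed F z = ∀ x → ρ x ∈ F → ρ (x + z) ∈ F

  Full : Subset k → Set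
  Full F = ∀ x → ρ x ∈ F

  closed-or-escapes : ∀ F z → NN ((∃[ x ] ρ x ∈ F × ρ (x + z) ∉ F) ⊎ Closed F z)
  closed-or-escapes F z = do
    no none ← ¬¬-excluded-middle {A = ∃[ x ] ρ x ∈ F × ρ (x + z) ∉ F}
      where yes some → return (inj₁ some)
    return (inj₂ λ x x∈ → case ρ (x + z) ∈? F of λ where
      (yes y∈) → y∈
      (no y∉)  → ⊥-elim (none (x , x∈ , y∉)))

  module _ {F : Subset k} where

    closed-+ : ∀ y z → Closed F y → Closed F z → Closed F (y + z)
    closed-+ y z cy cz x x∈ = subst (λ w → ρ w ∈ F) (+-assoc x y z) (cz (x + y) (cy x x∈))

    closed-* : ∀ j z → Closed F z → Closed F (j * z)
    closed-* zero    z cz x x∈ = subst (λ w → ρ w ∈ F) (sym (+-identityʳ x)) x∈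
    closed-* (suc j) z cz = closed-+ z (j * z) cz (closed-* j z cz)

    closed-≈ : ∀ {y z} → y ≈ z → Closed F y → Closed F z
    closed-≈ {y} {z} eq cy x x∈ = subst (_∈ F) (ρ-cong {x + y} {x + z} (subst₂ _≈_ (+-comm y x) (+-comm z x) (+-cong-≈ {y} {z} x eq))) (cy x x∈)

    closed-1⇒full : ρ 0 ∈ F → Closed F 1 → Full F
    closed-1⇒full 0∈ c x = subst (λ w → ρ w ∈ F) (*-identityʳ x) (closed-* x 1 c 0 0∈)

    closed-unit⇒full : ∀ {u} → ρ 0 ∈ F → Coprime u k → Closed F u → Full F
    closed-unit⇒full {u} 0∈ coprime cu = closed-1⇒full 0∈ (case coprime-Bézout coprime of λ where
        (Bézout.+- x y eq) → closed-≈ (trans (cong (_% k) (sym eq)) (drop-multiple 1 y)) (closed-* x u cu)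
        -- Here `x * u` is -1 mod k, and multiplying by `k′`, also -1, gives 1.
        (Bézout.-+ x y eq) → closed-≈ (trans (sym (drop-multiple (k′ * (x * u)) y)) (trans (cong (_% k) (flip x y eq)) (drop-multiple 1 (x * u))))
          (closed-* k′ (x * u) (closed-* x u cu)))
      where
      regroup : ∀ k′ z → k′ * z + suc z ≡ 1 + z * suc k′
      regroup = solve-∀
      flip : ∀ x y → 1 + x * u ≡ y * k → k′ * (x * u) + y * k ≡ 1 + (x * u) * k
      flip x y eq = trans (cong (k′ * (x * u) +_) (sym eq)) (regroup k′ (x * u))

    -- Since `k′` is -1 mod k, `l₂ + k′ * l₁` stands for l₂ - l₁. With l₁ + l₂ = 2h + 1, adding the
    -- even number 2(l₁ - h) turns this difference into 1.
    closed-odd⇒full : ∀ {l₁ l₂} → ρ 0 ∈ F → parity (l₁ + l₂) ≡ 1ℙ → Closed F 2 → Closed F (l₂ + k′ * l₁) → Full F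
    closed-odd⇒full {l₁} {l₂} 0∈ odd c₂ c = case half (l₁ + l₂) odd of λ where
        (h , eq) → closed-1⇒full 0∈ (closed-≈ (trans (cong (_% k) (total h eq)) (drop-multiple 1 (2 * h + l₁)))
          (closed-+ (l₂ + k′ * l₁) ((l₁ + k′ * h) * 2) c (closed-* (l₁ + k′ * h) 2 c₂)))
      where
      half : ∀ l → parity l ≡ 1ℙ → ∃[ h ] l ≡ suc (2 * h)
      half 1 odd = 0 , refl
      half (suc (suc l)) odd with half l odd
      ... | h , refl = suc h , cong suc (sym (*-suc 2 h))
      collect : ∀ l₁ l₂ k′ h → (l₂ + k′ * l₁) + (l₁ + k′ * h) * 2 ≡ (l₁ + l₂) + (k′ * (2 * h) + (l₁ + k′ * l₁))
      collect = solve-∀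
      finish : ∀ l₁ k′ h → suc (2 * h) + (k′ * (2 * h) + (l₁ + k′ * l₁)) ≡ 1 + (2 * h + l₁) * suc k′
      finish = solve-∀
      total : ∀ h → l₁ + l₂ ≡ suc (2 * h) → (l₂ + k′ * l₁) + (l₁ + k′ * h) * 2 ≡ 1 + (2 * h + l₁) * k
      total h eq = trans (collect l₁ l₂ k′ h) (trans (cong (_+ (k′ * (2 * h) + (l₁ + k′ * l₁))) eq) (finish l₁ k′ h))

-- Chains of gadgets and the growth of the set of attained residues.

module Chains {n : ℕ} (G : Graph n) (b : ℕ) (1≤b : 1 ≤ b) (M q : ℕ) (n<Mq : n < M * suc q) (k′ : ℕ) where

  open Walks G
  open Expansion G b 1≤b M q n<Mq
  open Exp
  open Gadgets G b 1≤b M q n<Mq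
  open Parities G b 1≤b M q n<Mq
  open Residues k′

  private
    k : ℕ
    k = suc k′
    variable
      e l₁ l₂ s T : ℕ
      start : Fin n

  -- Within H₀ ─ H there are routes from start to x of every length base + d with d mod k in F.
  record Chain (H₀ : Subset n) (start : Fin n) (e T : ℕ) : Set where
    field
      H      : Subset n
      exp    : Exp e H
      H⊆H₀   : H ⊆ H₀
      x      : Fin n
      x∈     : x ∈ H
      used   : ∀ Y → Y ⊆ H₀ → Disjoint Y H → ∣ Y ∣ ≤ T
      base   : ℕ
      F      : Subset k
      0∈F    : ρ 0 ∈ F
      attain : ∀ d → ρ d ∈ F → ∃[ l ] l ≈ base + d × Path (H₀ ─ H) start x l

  -- The first route shifts all lengths by `l₁`, which the new base absorbs, so the old residues
  -- persist. Taking the second route after residue `d` gives d + l₂ - l₁ relative to that base.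
  extend-chain : ∀ {H₀} (c : Chain H₀ start (suc e) T) → let open Chain c in
    Gadget e H s x l₁ l₂ → ∀ d → ρ d ∈ F → ρ (d + (l₂ + k′ * l₁)) ∉ F →
    Σ[ c′ ∈ Chain H₀ start e (T + s) ] ∣ Chain.F c′ ∣ ≡ suc ∣ F ∣
  extend-chain {start} {e} {T} {s} {l₁} {l₂} {H₀} c g d d∈ new∉ = record
    { H = H′ ; exp = exp′ ; H⊆H₀ = H⊆H₀ ∘ H′⊆H ; x = target ; x∈ = target∈
    ; used = λ Y Y⊆ Y# → ≤-trans (cover-≤ Y (Y ─ H) (Y ∩ H) λ {v} v∈ → case v ∈? H of λ where
          (yes v∈H) → inj₂ (x∈p∩q⁺ (v∈ , v∈H))
          (no v∉H)  → inj₁ (x∈p∧x∉q⇒x∈p─q v∈ v∉H))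
        (+-mono-≤ (used (Y ─ H) (Y⊆ ∘ p─q⊆p Y H) (x∈p─q⇒x∉q Y H))
          (small (Y ∩ H) (p∩q⊆q Y H) (Y# ∘ p∩q⊆p Y H)))
    ; base = base + l₁ ; F = F ∪ ⁅ new ⁆ ; 0∈F = x∈p∪q⁺ (inj₁ 0∈F)
    ; attain = λ d′ d′∈ → [ old d′ , (λ d′∈new → fresh d′ (ρ-injective {d′} {d + (l₂ + k′ * l₁)} (x∈⁅y⁆⇒x≡y new d′∈new))) ]′ (x∈p∪q⁻ F ⁅ new ⁆ d′∈)
    } , ∪⁅⁆-size new∉
    where
    open Chain c
    open Gadget g renaming (exp to exp′)
    new = ρ (d + (l₂ + k′ * l₁))
    join : ∀ {l l′} → Path (H₀ ─ H) start x l → Path (H ─ H′) x target l′ → Path (H₀ ─ H′) start target (l + l′)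
    join p p′ = append p p′ (λ v∈ v∈′ → x∈p─q⇒x∉q H₀ H v∈ (p─q⊆p H H′ v∈′))
      (λ v∈ → x∈p∧x∉q⇒x∈p─q (p─q⊆p H₀ H v∈) (x∈p─q⇒x∉q H₀ H v∈ ∘ H′⊆H))
      (λ v∈ → x∈p∧x∉q⇒x∈p─q (H⊆H₀ (p─q⊆p H H′ v∈)) (x∈p─q⇒x∉q H H′ v∈))
    swapʳ : ∀ x y z → x + y + z ≡ x + z + y
    swapʳ = solve-∀
    old : ∀ d′ → ρ d′ ∈ F → ∃[ l ] l ≈ base + l₁ + d′ × Path (H₀ ─ H′) start target l
    old d′ d′∈ = case attain d′ d′∈ of λ where
      (l , l≈ , p) → l + l₁ , trans (+-cong-≈ {l} {base + d′} l₁ l≈) (cong (_% k) (swapʳ base d′ l₁)) , join p path₁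
    regroup : ∀ base d l₁ l₂ k′ → base + d + l₂ + l₁ * suc k′ ≡ d + (l₂ + k′ * l₁) + (base + l₁)
    regroup = solve-∀
    fresh : ∀ d′ → d′ ≈ d + (l₂ + k′ * l₁) → ∃[ l ] l ≈ base + l₁ + d′ × Path (H₀ ─ H′) start target l
    fresh d′ d′≈ = case attain d d∈ of λ where
      (l , l≈ , p) → l + l₂ , trans (+-cong-≈ {l} {base + d} l₂ l≈) (trans (sym (drop-multiple (base + d + l₂) l₁))
          (trans (cong (_% k) (regroup base d l₁ l₂ k′)) (trans (sym (+-cong-≈ {d′} {d + (l₂ + k′ * l₁)} (base + l₁) d′≈)) (cong (_% k) (+-comm d′ (base + l₁))))))
        , join p path₂

  module Steps (p E : ℕ) (2≤n : 2 ≤ n) (unit : ∀ δ → 1 ≤ δ → δ < p → Coprime (2 * δ) k ⊎ p ≡ 2) where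

    -- In order: the threshold of `cycle-step`, the path from which `long-cycle` obtains that many
    -- exits, the resulting bound on the cycle, the cycle with its tail, and the part of `H` this
    -- costs by `Core.small`. The uniform bound `E` replaces `suc e + b`, so that all stages share
    -- the same values.
    min-length path-length cycle-length removed lost : ℕ
    min-length   = suc (E * (p + p) + p * (b * diameter))
    path-length  = E * suc min-length
    cycle-length = path-length + (2 + ((path-length + b * path-length) + (diameter + (path-length + b * path-length))))
    removed      = cycle-length + diameter
    lost         = removed + b * removed

    Progress : Subset n → Fin n → ℕ → ℕ → ℕ → Set
    Progress H₀ start e T size = Σ[ c ∈ Chain H₀ start e (T + lost) ] ∣ Chain.F c ∣ ≡ suc size

    chain-step : ∀ {H₀} (c : Chain H₀ start (suc e) T) → 1 ≤ e → suc e + b ≤ E → b + suc (suc e) ≤ p * suc e → Small removed →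
      NN (Full (Chain.F c) ⊎ Progress H₀ start e T ∣ Chain.F c ∣)
    chain-step {start} {e} {T} {H₀} c 1≤e E≥ rate small = do
      long ← long-cycle exp 1≤e x∈ E min-length E≥ (Small-mono path≤ small) (s≤s z≤n)
      l₁ , l₂ , l₁′ , l₂′ , δ , 1≤δ , δ<p , g , g′ , eq ←
        cycle-step exp 1≤e x∈ p min-length cycle-length rate
          (s≤s (+-monoˡ-≤ (p * (b * diameter)) (*-monoˡ-≤ (p + p) E≥))) small long
      inj₂ closed₁ ← closed-or-escapes F (l₂ + k′ * l₁)
        where inj₁ (d , d∈ , new) → return (inj₂ (extend-chain c g d d∈ new))
      -- The second gadget is used with its routes exchanged, so that adding the two translations
      -- yields `2 * δ`.
      inj₂ closed₂ ← closed-or-escapes F (l₁′ + k′ * l₂′)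
        where inj₁ (d , d∈ , new) → return (inj₂ (extend-chain c (swap g′) d d∈ new))
      let closed-2δ : Closed F (2 * δ)
          closed-2δ = closed-≈ (shift-sum l₁ l₂ l₁′ l₂′ δ eq) (closed-+ (l₂ + k′ * l₁) (l₁′ + k′ * l₂′) closed₁ closed₂)
      [ (λ (coprime : Coprime (2 * δ) k) → return (inj₁ (closed-unit⇒full {u = 2 * δ} 0∈F coprime closed-2δ)))
        , (λ p≡2 → even-case p≡2 1≤δ δ<p closed-2δ) ]′ (unit δ 1≤δ δ<p)
      where
      open Chain c
      path≤ : path-length ≤ removed
      path≤ = ≤-trans (m≤m+n path-length _) (m≤m+n cycle-length diameter)
      odd-walk≤ : suc (diameter + diameter) ≤ removed
      odd-walk≤ = +-monoˡ-≤ diameter (≤-trans (s≤s (≤-trans (m≤m+n diameter _) (m≤n+m _ (path-length + b * path-length))))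
        (≤-trans (n≤1+n _) (m≤n+m _ path-length)))
      regroup : ∀ l₁ l₂ l₁′ l₂′ k′ → (l₂ + k′ * l₁) + (l₁′ + k′ * l₂′) ≡ (l₁′ + l₂) + k′ * (l₁ + l₂′)
      regroup = solve-∀
      regroup′ : ∀ l₁ l₂′ δ k′ → (l₂′ + l₁ + 2 * δ) + k′ * (l₁ + l₂′) ≡ 2 * δ + (l₁ + l₂′) * suc k′
      regroup′ = solve-∀
      shift-sum : ∀ l₁ l₂ l₁′ l₂′ δ → l₁′ + l₂ ≡ l₂′ + l₁ + 2 * δ → (l₂ + k′ * l₁) + (l₁′ + k′ * l₂′) ≈ 2 * δ
      shift-sum l₁ l₂ l₁′ l₂′ δ eq = trans (cong (_% k) (trans (regroup l₁ l₂ l₁′ l₂′ k′)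
        (trans (cong (_+ k′ * (l₁ + l₂′)) eq) (regroup′ l₁ l₂′ δ k′)))) (drop-multiple (2 * δ) (l₁ + l₂′))
      even-case : ∀ {δ} → p ≡ 2 → 1 ≤ δ → δ < p → Closed F (2 * δ) → NN (Full F ⊎ Progress H₀ start e T ∣ F ∣)
      even-case {δ} p≡2 1≤δ δ<p closed-2δ = do
        l₁ , l₂ , odd , g ← parity-step exp 1≤e b≤e 2≤n x∈ removed odd-walk≤ small
        inj₂ closed₃ ← closed-or-escapes F (l₂ + k′ * l₁)
          where inj₁ (d , d∈ , new) → return (inj₂ (extend-chain c g d d∈ new))
        return (inj₁ (closed-odd⇒full {F = F} {l₁} {l₂} 0∈F odd (subst (λ δ → Closed F (2 * δ)) δ≡1 closed-2δ) closed₃))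
        where
        δ≡1 : δ ≡ 1
        δ≡1 = ≤-antisym (s≤s⁻¹ (≤-trans δ<p (≤-reflexive p≡2))) 1≤δ
        double : ∀ e → 2 * suc e ≡ e + suc (suc e)
        double = solve-∀
        -- For p = 2 the rate condition says exactly that the expansion `suc e / b` exceeds 1.
        b≤e : b ≤ e
        b≤e = +-cancelʳ-≤ (suc (suc e)) b e (≤-trans rate (≤-reflexive (trans (cong (_* suc e) p≡2) (double e))))

    -- `j` is at once a bound on the missing residues and a stock of rate units: each gadget spends
    -- one unit and attains one new residue.
    complete-chain : ∀ {H₀} j e {T} → 1 ≤ e → e + j + b ≤ E → b + suc e ≤ p * e → 1 ≤ p → Small removed →
      (c : Chain H₀ start (e + j) T) → k ≤ ∣ Chain.F c ∣ + j →
      NN (∃[ e′ ] ∃[ T′ ] 1 ≤ e′ × T′ ≤ T + j * lost × Σ[ c′ ∈ Chain H₀ start e′ T′ ] Full (Chain.F c′))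
    complete-chain zero e {T} 1≤e _ _ _ _ c k≤ = return (e + 0 , T , ≤-trans 1≤e (m≤m+n e 0) , m≤m+n T 0 , c
      , λ x → subst (ρ x ∈_) (sym (∣p∣≡n⇒p≡⊤ (≤-antisym (∣p∣≤n (Chain.F c)) (≤-trans k≤ (≤-reflexive (+-identityʳ _)))))) ∈⊤)
    complete-chain {start} {H₀} (suc j) e {T} 1≤e E≥ rate 1≤p small c₀ k≤ = do
      let c = subst (λ e → Chain H₀ start e T) (+-suc e j) c₀
          F≡ : ∣ Chain.F c ∣ ≡ ∣ Chain.F c₀ ∣
          F≡ = F-subst (+-suc e j) c₀
          E≥′ : suc (e + j) + b ≤ E
          E≥′ = ≤-trans (≤-reflexive (cong (_+ b) (sym (+-suc e j)))) E≥
      inj₂ (c′ , F′≡) ← chain-step c (≤-trans 1≤e (m≤m+n e j)) E≥′ rate′ small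
        where inj₁ full → return (suc (e + j) , T , s≤s z≤n , m≤m+n T _ , c , full)
      e′ , T′ , 1≤e′ , T′≤ , c″ , full ← complete-chain j e 1≤e (≤-trans (n≤1+n _) E≥′) rate 1≤p small c′
        (≤-trans k≤ (≤-reflexive (trans (+-suc ∣ Chain.F c₀ ∣ j) (cong (_+ j) (sym (trans F′≡ (cong suc F≡)))))))
      return (e′ , T′ , 1≤e′ , ≤-trans T′≤ (≤-reflexive (+-assoc T lost (j * lost))) , c″ , full)
      where
      F-subst : ∀ {e e′} (eq : e ≡ e′) (c : Chain H₀ start e T) → ∣ Chain.F (subst (λ e → Chain H₀ start e T) eq c) ∣ ≡ ∣ Chain.F c ∣
      F-subst refl c = refl
      rate′ : b + suc (suc (e + j)) ≤ p * suc (e + j)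
      rate′ = ≤-trans (≤-reflexive (shiftˡ b e j)) (≤-trans (+-mono-≤ rate (≤-trans (≤-reflexive (sym (*-identityˡ (suc j)))) (*-monoˡ-≤ (suc j) 1≤p)))
        (≤-reflexive (shiftʳ p e j)))
        where
        shiftˡ : ∀ b e j → b + suc (suc (e + j)) ≡ (b + suc e) + suc j
        shiftˡ = solve-∀
        shiftʳ : ∀ p e j → p * e + p * suc j ≡ p * suc (e + j)
        shiftʳ = solve-∀

-- Closing the chain to a cycle through the reserved set.

module Closing {n : ℕ} (G : Graph n) (b : ℕ) (1≤b : 1 ≤ b) (M q : ℕ) (n<Mq : n < M * suc q) (k′ : ℕ) (1≤k′ : 1 ≤ k′) where

  open Walks G
  open Expansion G b 1≤b M q n<Mq
  open Exp
  open Residues k′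
  open Chains G b 1≤b M q n<Mq k′

  private
    k : ℕ
    k = suc k′
    variable
      e T l : ℕ
      u v : Fin n

  last-step : ∀ {P} → Walk P u v (suc l) → ∃[ w ] w ∈ P × Adj w v × Walk P u w l
  last-step (step u∈ a []) = _ , u∈ , a , []
  last-step (step u∈ a (step w∈ a′ wk)) = case last-step (step w∈ a′ wk) of λ where
    (w , w∈′ , a″ , wk′) → w , w∈′ , a″ , step u∈ a wk′

  connected-set : Exp e ⊤ → 1 ≤ e → ∀ r m → 2 * m ≤ n →
    ∃[ A ] ∣ A ∣ ≡ suc m × r ∈ A × (∀ v → v ∈ A → ∃[ l ] Walk A v r l)
  connected-set ex 1≤e r zero _ = ⁅ r ⁆ , ∣⁅x⁆∣≡1 r , x∈⁅x⁆ r
    , λ v v∈ → 0 , subst (λ v → Walk ⁅ r ⁆ v r 0) (sym (x∈⁅y⁆⇒x≡y r v∈)) []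
  connected-set {e} ex 1≤e r (suc m) m≤ = case connected-set ex 1≤e r m (≤-trans (*-monoʳ-≤ 2 (n≤1+n m)) m≤) of λ where
      (A , A≡ , r∈ , conn) → case 1≤∣∣⇒∈ (sub (fringe? A)) (nonempty A A≡) of λ where
        (v , v∈) → case ∈sub⁻ (fringe? A) v∈ of λ where
          (v∉A , u , u∈A , a) → A ∪ ⁅ v ⁆ , trans (∪⁅⁆-size v∉A) (cong suc A≡) , x∈p∪q⁺ (inj₁ r∈)
            , λ w w∈ → case x∈p∪q⁻ A ⁅ v ⁆ w∈ of λ where
                (inj₁ w∈A) → case conn w w∈A of λ where
                  (l , wk) → l , weakenʷ (p⊆p∪q ⁅ v ⁆) wk
                (inj₂ w∈v) → case conn u u∈A of λ where
                  (l , wk) → suc l , subst (λ w → Walk (A ∪ ⁅ v ⁆) w r (suc l)) (sym (x∈⁅y⁆⇒x≡y v w∈v))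
                    (step (x∈p∪q⁺ (inj₂ (x∈⁅x⁆ v))) (adj-sym a) (weakenʷ (p⊆p∪q ⁅ v ⁆) wk))
    where
    fringe? : ∀ A v → Dec (v ∉ A × ∃[ u ] u ∈ A × Adj u v)
    fringe? A v = ¬? (v ∈? A) ×-dec Fin.any? λ u → (u ∈? A) ×-dec Adj? u v
    nonempty : ∀ A → ∣ A ∣ ≡ suc m → 1 ≤ ∣ sub (fringe? A) ∣
    nonempty A A≡ = ≰⇒> λ Y≤0 → <⇒≱ (*-mono-≤ 1≤e (≤-trans (s≤s z≤n) (≤-reflexive (sym A≡))))
      (≤-trans (expand ex A (sub (fringe? A)) (λ _ → ∈⊤) (λ u v u∈ a _ v∉ → ∈sub⁺ (fringe? A) (v∉ , u , u∈ , a))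
        (≤-trans (≤-reflexive (cong (2 *_) A≡)) m≤))
      (≤-trans (*-monoʳ-≤ b Y≤0) (≤-reflexive (*-zeroʳ b))))

  -- A is set aside at the outset; a chain starting at s in H₀ will be closed up through it.
  record Reserve (H₀ A : Subset n) : Set where
    field
      s a   : Fin n
      s∈    : s ∈ H₀
      a∉    : a ∉ H₀
      a~s   : Adj a s
      A-conn : ∀ v → v ∈ A → ∃[ l ] Walk (∁ H₀) v a l

  -- Follow a walk from `r` until it first enters `H₀`: `s` is the entry and `a` the vertex before
  -- it. As the walk so far avoids `H₀`, all of `A` reaches `a` outside `H₀` by way of `r`.
  reserve : ∀ {A H₀ r h} → Exp e ⊤ → 1 ≤ e → r ∈ A → (∀ v → v ∈ A → ∃[ l ] Walk A v r l) → Disjoint A H₀ → h ∈ H₀ →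
    Reserve H₀ A
  reserve {A = A} {H₀} {r} {h} ex 1≤e r∈ conn A#H₀ h∈ = case Exp-connected ex 1≤e (∈⊤ {x = r}) (∈⊤ {x = h}) of λ where
    (_ , _ , wk) → case first-hit H₀ wk h∈ of λ where
      (s , zero , s∈ , _ , []) → ⊥-elim (A#H₀ r∈ s∈)
      (s , suc l , s∈ , _ , wk′) → case last-step wk′ of λ where
        (a , a∈ , a~s , wk″) → record
          { s = s ; a = a ; s∈ = s∈ ; a∉ = x∈p─q⇒x∉q ⊤ H₀ a∈ ; a~s = a~s
          ; A-conn = λ v v∈ → case conn v v∈ of λ where
              (l′ , wk‴) → l′ + l , appendʷ (weakenʷ (λ v∈ → x∉p⇒x∈∁p (A#H₀ v∈)) wk‴)
                                         (weakenʷ (λ v∈ → x∉p⇒x∈∁p (x∈p─q⇒x∉q ⊤ H₀ v∈)) wk″)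
          }

  -- The consumed part H₀ ─ H is too small to separate the reserve from H.
  return-path : ∀ {A H₀} → Exp 1 ⊤ → 1 ≤ e → (R : Reserve H₀ A) → (c : Chain H₀ (Reserve.s R) e T) → b * T < ∣ A ∣ → Disjoint A H₀ →
    NN (∃[ l ] Walk (∁ (H₀ ─ Chain.H c)) (Chain.x c) (Reserve.a R) l)
  return-path {A = A} {H₀} ex 1≤e R c T-small A#H₀ = do
    Y , Y⁺ , Y⁻ ← comprehension λ v → v ∈ W × ∃[ l ] Walk W v a l
    return (join Y Y⁺ Y⁻)
    where
    open Reserve R
    open Chain c
    B = H₀ ─ H
    W = ∁ B
    ∁H₀⊆W : ∁ H₀ ⊆ W
    ∁H₀⊆W v∈ = x∉p⇒x∈∁p λ v∈B → x∈∁p⇒x∉p v∈ (p─q⊆p H₀ H v∈B)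
    H⊆W : H ⊆ W
    H⊆W v∈ = x∉p⇒x∈∁p λ v∈B → x∈p─q⇒x∉q H₀ H v∈B v∈
    join : ∀ Y → (∀ v → v ∈ W × (∃[ l ] Walk W v a l) → v ∈ Y) → (∀ v → v ∈ Y → v ∈ W × ∃[ l ] Walk W v a l) → ∃[ l ] Walk W x a l
    join Y Y⁺ Y⁻ = case big-meet Y H Y-big (Exp-big exp 1≤e x∈) of λ where
        (y , y∈Y , y∈H) → case Exp-connected exp 1≤e x∈ y∈H ,′ Y⁻ y y∈Y of λ where
          ((l , _ , wk) , (_ , l′ , wk′)) → l + l′ , appendʷ (weakenʷ H⊆W wk) wk′
      where
      A⊆Y : A ⊆ Y
      A⊆Y {v} v∈ = case A-conn v v∈ of λ where
        (l , wk) → Y⁺ v (∁H₀⊆W (x∉p⇒x∈∁p (A#H₀ v∈)) , l , weakenʷ ∁H₀⊆W wk)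
      nbhd : ∀ u v → u ∈ Y → Adj u v → v ∈ ⊤ → v ∉ Y → v ∈ B
      nbhd u v u∈ a _ v∉ = case v ∈? B of λ where
        (yes v∈B) → v∈B
        (no v∉B) → case Y⁻ u u∈ of λ where
          (_ , l , wk) → ⊥-elim (v∉ (Y⁺ v (x∉p⇒x∈∁p v∉B , suc l , step (x∉p⇒x∈∁p v∉B) (adj-sym a) wk)))
      -- All neighbours of `Y` outside it lie in the consumed part, which has at most `T` vertices.
      -- If `Y` were at most n / 2, its size, and with it that of `A`, would be at most `b * T`.
      Y-big : n < 2 * ∣ Y ∣
      Y-big = ≰⇒> λ Y≤ → <⇒≱ T-small (≤-trans (p⊆q⇒∣p∣≤∣q∣ A⊆Y) (≤-trans (≤-reflexive (sym (*-identityˡ ∣ Y ∣)))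
        (≤-trans (expand ex Y B (λ _ → ∈⊤) nbhd Y≤) (*-monoʳ-≤ b (used B (p─q⊆p H₀ H) (x∈p─q⇒x∉q H₀ H))))))

  0≉1 : ¬ 0 ≈ 1
  0≉1 eq = case trans (trans (sym (m<n⇒m%n≡m {k} {0} (s≤s z≤n))) eq) (m<n⇒m%n≡m {k} {1} (s≤s 1≤k′)) of λ ()

  -- Residues 0 and 1 cannot both come from the empty path.
  start-used : ∀ {H₀ s} (c : Chain H₀ s e T) → Full (Chain.F c) → s ∈ H₀ ─ Chain.H c
  start-used {s = s} c full = case attain 0 (full 0) ,′ attain 1 (full 1) of λ where
      ((_ , _ , step s∈ _ _) , _) → s∈
      (_ , (_ , _ , step s∈ _ _)) → s∈
      ((_ , l≈ , []) , (_ , l′≈ , [])) → ⊥-elim (0≉1 (cancel base (trans (sym l≈) l′≈)))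
    where
    open Chain c
    regroup : ∀ base d k′ → base + d + k′ * base ≡ d + base * suc k′
    regroup = solve-∀
    reduce : ∀ base d → base + d + k′ * base ≈ d
    reduce base d = trans (cong (_% k) (regroup base d k′)) (drop-multiple d base)
    cancel : ∀ base → base + 0 ≈ base + 1 → 0 ≈ 1
    cancel base eq = trans (sym (reduce base 0)) (trans (+-cong-≈ {base + 0} {base + 1} (k′ * base) eq) (reduce base 1))

  close-chain : ∀ {A H₀} → Exp 1 ⊤ → 1 ≤ e → (R : Reserve H₀ A) → (c : Chain H₀ (Reserve.s R) e T) → Full (Chain.F c) →
    b * T < ∣ A ∣ → Disjoint A H₀ → ∀ t → NN (∃[ s ] ∃[ l ] 3 ≤ l × l ≈ t × Path ⊤ s s l)
  close-chain {H₀ = H₀} ex 1≤e R c full T-small A#H₀ t = do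
    _ , wk ← return-path ex 1≤e R c T-small A#H₀
    return (finish (first-hit ⁅ a ⁆ wk (x∈⁅x⁆ a)))
    where
    open Reserve R
    open Chain c
    B = H₀ ─ H
    W = ∁ B
    s∈B : s ∈ B
    s∈B = start-used c full
    s≢x : s ≢ x
    s≢x s≡x = x∈p─q⇒x∉q H₀ H s∈B (subst (_∈ H) (sym s≡x) x∈)
    x≢a : x ≢ a
    x≢a x≡a = a∉ (subst (_∈ H₀) x≡a (H⊆H₀ x∈))
    regroup : ∀ base t r k′ → base + (t + k′ * (base + r)) + r ≡ t + (base + r) * suc k′
    regroup = solve-∀
    finish : ∀ {l₀} → ∃[ y ] ∃[ l ] y ∈ ⁅ a ⁆ × l ≤ l₀ × Walk (W ─ ⁅ a ⁆) x y l → ∃[ s ] ∃[ l ] 3 ≤ l × l ≈ t × Path ⊤ s s l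
    finish (y , _ , y∈ , _ , wk) = case toPath (subst (λ y → Walk (W - a) x y _) (x∈⁅y⁆⇒x≡y a y∈) wk) of λ where
      -- The residue requested is t - base - (r + 1), which makes the closed length congruent to
      -- `t`.
      (r , _ , p) → case attain (t + k′ * (base + (r + 1))) (full (t + k′ * (base + (r + 1)))) of λ where
        (l , l≈ , p′) → s , l + (r + 1)
          -- One edge at least from the chain, one from the return path, and the edge from `a` to
          -- `s`.
          , +-mono-≤ (nonempty-path p′ s≢x) (+-monoˡ-≤ 1 (nonempty-path p x≢a))
          , trans (+-cong-≈ {l} {base + (t + k′ * (base + (r + 1)))} (r + 1) l≈)
              (trans (cong (_% k) (regroup base t (r + 1) k′)) (drop-multiple t (base + (r + 1))))
          , append p′ (append p (edge (x∈⁅x⁆ a) a~s) (x∈p─q⇒x∉q W ⁅ a ⁆) (p─q⊆p W ⁅ a ⁆)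
              (⁅⁆⊆ (x∉p⇒x∈∁p λ a∈B → a∉ (p─q⊆p H₀ H a∈B))))
              (λ v∈B v∈W → x∈∁p⇒x∉p v∈W v∈B) (λ _ → ∈⊤) (λ _ → ∈⊤)

  module Main (p E : ℕ) (2≤n : 2 ≤ n) (unit : ∀ δ → 1 ≤ δ → δ < p → Coprime (2 * δ) k ⊎ p ≡ 2) where

    open Steps p E 2≤n unit

    -- Of the rate above `e`, one unit pays for removing the reserve and `k` for the chain. The
    -- reserve has one vertex more than `b` times the most that `k` gadgets can consume, as
    -- `return-path` demands.
    cycle-mod-k : ∀ e → Exp (suc (e + k)) ⊤ → 1 ≤ e → e + k + b ≤ E → b + suc e ≤ p * e → 1 ≤ p →
      Fin n → Small (suc (b * (k * lost))) → ∀ t → NN (∃[ s ] ∃[ l ] 3 ≤ l × l ≈ t × Path ⊤ s s l)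
    cycle-mod-k e ex 1≤e E≥ rate 1≤p r small t = do
      let A , A≡ , r∈ , conn = connected-set ex (s≤s z≤n) r (b * (k * lost)) half
          A-small = Small-mono (≤-reflexive A≡) small
      K ← core ex (≤-trans 1≤e (m≤m+n e k)) (∈⊤ {x = r}) A A-small
      let A#H₀ : Disjoint A (Core.H′ K)
          A#H₀ = λ v∈A v∈ → Core.Z#S K (Core.H′⊆Z K v∈) v∈A
          R = reserve ex (s≤s z≤n) r∈ conn A#H₀ (Core.centre∈ K)
      e′ , T , 1≤e′ , T≤ , c , full ← complete-chain k e 1≤e E≥ rate 1≤p (Small-mono removed≤ small)
        (initial (Core.exp K) (Reserve.s∈ R)) (m≤n+m k ∣ ⁅ ρ 0 ⁆ ∣)
      close-chain (Exp-mono (s≤s z≤n) ex) 1≤e′ R c full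
        (≤-trans (s≤s (*-monoʳ-≤ b T≤)) (≤-reflexive (sym A≡))) A#H₀ t
      where
      m₀ = suc (b * (k * lost))
      half : 2 * (b * (k * lost)) ≤ n
      half = ≤-trans (*-monoʳ-≤ 2 (≤-trans (n≤1+n (b * (k * lost))) (m≤m+n m₀ (b * m₀)))) (Small⇒2* {m₀} small)
      removed≤ : removed ≤ suc (b * (k * lost))
      removed≤ = ≤-trans (≤-trans (m≤m+n removed (b * removed)) (≤-trans (m≤m+n lost (k′ * lost))
        (≤-trans (≤-reflexive (sym (*-identityˡ (k * lost)))) (*-monoˡ-≤ (k * lost) 1≤b)))) (n≤1+n _)
      initial : ∀ {H₀ s e} → Exp e H₀ → s ∈ H₀ → Chain H₀ s e 0
      initial {H₀} {s} exp s∈ = record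
        { H = H₀ ; exp = exp ; H⊆H₀ = id ; x = s ; x∈ = s∈
        ; used = λ Y Y⊆ Y# → ≮⇒≥ λ 0< → case 1≤∣∣⇒∈ Y 0< of λ { (v , v∈) → Y# v∈ (Y⊆ v∈) }
        ; base = 0 ; F = ⁅ ρ 0 ⁆ ; 0∈F = x∈⁅x⁆ (ρ 0)
        ; attain = λ d d∈ → 0 , sym (ρ-injective {d} {0} (x∈⁅y⁆⇒x≡y (ρ 0) d∈)) , [] }

-- Closed paths as cycles, and decidability of their existence.

module Cycles {n : ℕ} (G : Graph n) where

  open Walks G

  path? : ∀ l P u v → Dec (Path P u v l)
  path? zero P u v with u Fin.≟ v
  ... | yes refl = yes []
  ... | no u≢v   = no λ { [] → u≢v refl }
  path? (suc l) P u v with u ∈? P | Fin.any? (λ w → Adj? u w ×-dec path? l (P - u) w v)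
  ... | yes u∈ | yes (w , a , p) = yes (step u∈ a p)
  ... | yes u∈ | no ¬p = no λ { (step {w = w} _ a p) → ¬p (w , a , p) }
  ... | no u∉  | _     = no λ { (step u∈ _ _) → u∉ u∈ }

  sources : ∀ {P u v l} → Path P u v l → List (Fin n)
  sources []                   = []
  sources (step {u = u} _ _ p) = u ∷ sources p

  length-sources : ∀ {P u v l} (p : Path P u v l) → length (sources p) ≡ l
  length-sources []           = refl
  length-sources (step _ _ p) = cong suc (length-sources p)

  sources⊆ : ∀ {P u v l} (p : Path P u v l) → All (_∈ P) (sources p)
  sources⊆ []                     = []
  sources⊆ {P} (step u∈ _ p) = u∈ ∷ All.map (x∈p-y⇒x∈p P) (sources⊆ p)

  sources-unique : ∀ {P u v l} (p : Path P u v l) → Unique (sources p)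
  sources-unique []               = []
  sources-unique {P} (step _ _ p) = All.map (λ v∈ u≡v → x∈p-y⇒x≢y P v∈ (sym u≡v)) (sources⊆ p) ∷ sources-unique p

  sources-closed : ∀ {P u v l} (p : Path P u v l) → ClosedWalkFrom G v (sources p)
  sources-closed []                        = _
  sources-closed (step _ a [])             = a
  sources-closed (step _ a p@(step _ _ _)) = a , sources-closed p

  path⇒cycle : ∀ {P s l} → Path P s s l → 3 ≤ l → Σ[ C ∈ Cycle G ] cycleLength C ≡ l
  path⇒cycle {l = suc l} p@(step _ _ _) 3≤l = record
    { vertices = sources p ; long = ≤-trans 3≤l (≤-reflexive (sym (length-sources p)))
    ; distinct = sources-unique p ; closed = sources-closed p } , length-sources p

  -- A path has at most `n` sources, so only finitely many start vertices and lengths need to be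
  -- searched.
  cycle-stable : ∀ k .{{_ : NonZero k}} t →
    NN (∃[ s ] ∃[ l ] 3 ≤ l × l % k ≡ t % k × Path ⊤ s s l) → ∃[ s ] ∃[ l ] 3 ≤ l × l % k ≡ t % k × Path ⊤ s s l
  cycle-stable k t ¬¬cycle with Fin.any? (λ s → Fin.any? {n = suc n} λ l →
    (3 ≤? toℕ l) ×-dec (toℕ l % k Nat.≟ t % k) ×-dec path? (toℕ l) ⊤ s s)
  ... | yes (s , l , found) = s , toℕ l , found
  ... | no none = ⊥-elim (¬¬cycle λ { (s , l , 3≤l , l≡ , p) →
    let l< = s≤s (≤-trans (length≤ p) (≤-reflexive (∣⊤∣≡n n))) in
    none (s , fromℕ< l< , subst (λ l → 3 ≤ l × l % k ≡ t % k × Path ⊤ s s l) (sym (Fin.toℕ-fromℕ< l<)) (3≤l , l≡ , p)) })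

-- The arithmetic of p and α, and the choice of the constants.

open import Data.Nat.Divisibility using (_∣_; ∣-trans; ∣⇒≤; m∣m*n; 0∣⇒≡0)
open import Data.Nat.Primality using (Prime; euclidsLemma; ¬prime[0]; ¬prime[1])
open import Data.Nat.Primality.Factorisation using (factorise)
open import Data.Nat.ListAction using (product)
open import Data.Integer as ℤ using (-[1+_])
import Data.Integer.Properties as ℤ
open import Data.Rational using (ℚ; mkℚ) renaming (_<_ to _<ℚ_; _≤_ to _≤ℚ_; _*_ to _*ℚ_)
import Data.Rational.Properties as ℚ
open import Data.Rational.Unnormalised using (mkℚᵘ; *≤*; *<*)
import Data.Rational.Unnormalised as ℚᵘ
import Data.Rational.Unnormalised.Properties as ℚᵘ

-- A common prime factor of `2 * δ` and `k` is at least `p`, yet divides 2 or the smaller number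
-- `δ`; only p = 2 allows this.
unit-or-two : ∀ k .{{_ : NonZero k}} p → 2 ≤ p → (∀ q → Prime q → q ∣ k → p ≤ q) → ∀ δ → 1 ≤ δ → δ < p → Coprime (2 * δ) k ⊎ p ≡ 2
unit-or-two k p 2≤p least δ 1≤δ δ<p with p Nat.≟ 2
... | yes p≡2 = inj₂ p≡2
... | no p≢2 = inj₁ λ { {d} (d∣2δ , d∣k) → only-one d d∣2δ d∣k }
  where
  no-prime : ∀ q → Prime q → q ∣ 2 * δ → ¬ q ∣ k
  no-prime q q-prime q∣2δ q∣k with euclidsLemma 2 δ q-prime q∣2δ
  ... | inj₁ q∣2 = p≢2 (≤-antisym (≤-trans (least q q-prime q∣k) (∣⇒≤ q∣2)) 2≤p)
  ... | inj₂ q∣δ = <⇒≱ δ<p (≤-trans (least q q-prime q∣k) (∣⇒≤ {{>-nonZero 1≤δ}} q∣δ))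
  only-one : ∀ d → d ∣ 2 * δ → d ∣ k → d ≡ 1
  only-one zero 0∣2δ _ = ⊥-elim (<⇒≱ (≤-trans 1≤δ (m≤m+n δ (1 * δ))) (≤-reflexive (0∣⇒≡0 0∣2δ)))
  only-one d@(suc _) d∣2δ d∣k with factorise d
  ... | record { factors = [] ; isFactorisation = eq } = eq
  ... | record { factors = q ∷ qs ; isFactorisation = eq ; factorsPrime = q-prime ∷ _ } =
    ⊥-elim (no-prime q q-prime (∣-trans q∣d d∣2δ) (∣-trans q∣d d∣k))
    where
    q∣d : q ∣ d
    q∣d = subst (q ∣_) (sym eq) (m∣m*n (product qs))

-- α = a / b₀ in terms of natural numbers.
rate-of : ∀ p′ (α : ℚ) → recipPred (2 + p′) <ℚ α → ∃[ a ] ∃[ b₀ ] 1 ≤ b₀ × b₀ < a * suc p′ ×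
  (∀ x y → α *ℚ ℕ→ℚ x ≤ℚ ℕ→ℚ y → a * x ≤ b₀ * y)
rate-of p′ α@(mkℚ num den-1 _) α> = num-nat num refl
  where
  α>ᵘ : mkℚᵘ (ℤ.+ 1) p′ ℚᵘ.< mkℚᵘ num den-1
  α>ᵘ = ℚᵘ.<-respˡ-≃ (ℚ.toℚᵘ-fromℚᵘ (mkℚᵘ (ℤ.+ 1) p′)) (ℚ.toℚᵘ-mono-< α>)
  num-nat : ∀ i → i ≡ num → ∃[ a ] ∃[ b₀ ] 1 ≤ b₀ × b₀ < a * suc p′ × (∀ x y → α *ℚ ℕ→ℚ x ≤ℚ ℕ→ℚ y → a * x ≤ b₀ * y)
  num-nat -[1+ _ ] refl with α>ᵘ
  ... | *<* ()
  num-nat (ℤ.+ a) refl = a , suc den-1 , s≤s z≤n , large , convert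
    where
    large : suc den-1 < a * suc p′
    large with α>ᵘ
    ... | *<* lt = ℤ.drop‿+<+ (subst₂ ℤ._<_ (ℤ.*-identityˡ (ℤ.+ suc den-1)) (sym (ℤ.pos-* a (suc p′))) lt)
    convert : ∀ x y → α *ℚ ℕ→ℚ x ≤ℚ ℕ→ℚ y → a * x ≤ suc den-1 * y
    convert x y le with ℚᵘ.≤-respʳ-≃ (ℚ.toℚᵘ-fromℚᵘ (mkℚᵘ (ℤ.+ y) 0)) (ℚᵘ.≤-respˡ-≃ (ℚᵘ.≃-trans (ℚ.toℚᵘ-homo-* α (ℕ→ℚ x))
        (ℚᵘ.*-congˡ {mkℚᵘ (ℤ.+ a) den-1} (ℚ.toℚᵘ-fromℚᵘ (mkℚᵘ (ℤ.+ x) 0)))) (ℚ.toℚᵘ-mono-≤ le))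
    ... | *≤* le′ = ℤ.drop‿+≤+ (subst₂ ℤ._≤_ (trans (ℤ.*-identityʳ (ℤ.+ a ℤ.* ℤ.+ x)) (sym (ℤ.pos-* a x)))
        (trans (sym (ℤ.pos-* y (suc den-1 * 1))) (cong ℤ.+_ (trans (cong (y *_) (*-identityʳ (suc den-1))) (*-comm y (suc den-1))))) le′)

expand-ℕ : ∀ {n} (G : Graph n) {a b₀ κ : ℕ} {α : ℚ} (1≤b : 1 ≤ b₀ * κ) (M q : ℕ) (n<Mq : n < M * suc q) →
  (∀ x y → α *ℚ ℕ→ℚ x ≤ℚ ℕ→ℚ y → a * x ≤ b₀ * y) → Expanding α G → Expansion.Exp G (b₀ * κ) 1≤b M q n<Mq (a * κ) ⊤
expand-ℕ {n} G {a} {b₀} {κ} 1≤b M q n<Mq convert expanding = Expansion.mkExp λ X Y _ N⊆Y X≤ → begin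
    a * κ * ∣ X ∣           ≡⟨ swapʳ a κ (∣ X ∣) ⟩
    κ * (a * ∣ X ∣)         ≤⟨ *-monoʳ-≤ κ (convert (∣ X ∣) (∣ N[ G ] X ∣) (expanding X X≤)) ⟩
    κ * (b₀ * ∣ N[ G ] X ∣) ≡⟨ swapʳ b₀ κ (∣ N[ G ] X ∣) ⟨
    b₀ * κ * ∣ N[ G ] X ∣   ≤⟨ *-monoʳ-≤ (b₀ * κ) (p⊆q⇒∣p∣≤∣q∣ (N⊆ X Y N⊆Y)) ⟩
    b₀ * κ * ∣ Y ∣          ∎
  where
  open ≤-Reasoning
  swapʳ : ∀ a κ x → a * κ * x ≡ κ * (a * x)
  swapʳ = solve-∀
  anyFin⁻ : ∀ {m} (f : Fin m → Bool) → anyFin f ≡ true → ∃[ i ] f i ≡ true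
  anyFin⁻ {suc m} f eq with f zero in f0
  ... | true  = zero , f0
  ... | false with anyFin⁻ (λ i → f (suc i)) eq
  ...   | i , fi = suc i , fi
  N⊆ : ∀ X Y → (∀ u v → u ∈ X → adj G u v ≡ true → v ∈ ⊤ → v ∉ X → v ∈ Y) → N[ G ] X ⊆ Y
  N⊆ X Y N⊆Y {v} v∈ with trans (sym (lookup∘tabulate _ v)) ([]=⇒lookup v∈)
  ... | eq with lookup X v in Xv
  ...   | false with anyFin⁻ (λ u → lookup X u ∧ adj G u v) eq
  ...     | u , both with lookup X u in Xu
  ...       | true = N⊆Y u v (lookup⇒[]= u X Xu) both ∈⊤ λ v∈X → case trans (sym Xv) ([]=⇒lookup v∈X) of λ ()

large-expanders : ∀ k′ → 1 ≤ k′ → ∀ p′ → (∀ q → Prime q → q ∣ suc k′ → 2 + p′ ≤ q) →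
  ∀ α a b₀ → 1 ≤ b₀ → b₀ < a * suc p′ → (∀ x y → α *ℚ ℕ→ℚ x ≤ℚ ℕ→ℚ y → a * x ≤ b₀ * y) →
  ∃[ n₀ ] ((r : ℕ) → r < suc k′ → (n : ℕ) → n₀ ≤ n → (G : Graph n) → Expanding α G →
    Σ[ C ∈ Cycle G ] ∃[ m ] (cycleLength C ≡ m * suc k′ + r))
large-expanders k′ 1≤k′ p′ least α a b₀ 1≤b₀ rate convert = n₀ , found
  where
  k = suc k′
  p = 2 + p′
  -- Scaling by `κ` turns the strict inequality b₀ < a(p - 1) into a gap of `κ`. Losing k + 1 units
  -- of rate costs (k + 1)(p - 1) of it, and the remaining 1 is what `rate-e` asks for.
  κ = suc (suc k * suc p′)
  b = b₀ * κ
  e = a * κ ∸ suc k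
  E = e + k + b
  1≤a : 1 ≤ a
  1≤a = ≰⇒> λ a≤0 → <⇒≱ rate (≤-trans (*-monoˡ-≤ (suc p′) a≤0) z≤n)
  κ≤aκ : κ ≤ a * κ
  κ≤aκ = ≤-trans (≤-reflexive (sym (*-identityˡ κ))) (*-monoˡ-≤ κ 1≤a)
  k<κ : suc k < κ
  k<κ = s≤s (≤-trans (≤-reflexive (sym (*-identityʳ (suc k)))) (*-monoʳ-≤ (suc k) (s≤s z≤n)))
  e+k : suc (e + k) ≡ a * κ
  e+k = trans (sym (+-suc e k)) (m∸n+n≡m (≤-trans (<⇒≤ k<κ) κ≤aκ))
  1≤e : 1 ≤ e
  1≤e = m<n⇒0<n∸m (≤-trans k<κ κ≤aκ)
  1≤b : 1 ≤ b
  1≤b = *-mono-≤ 1≤b₀ (s≤s z≤n)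
  rate-e : b + suc e ≤ p * e
  rate-e = +-cancelʳ-≤ (suc p′ * suc k) _ _ (begin
      b₀ * κ + suc e + suc p′ * suc k ≡⟨ regroup₁ b₀ k p′ e ⟩
      suc b₀ * κ + e                  ≤⟨ +-monoˡ-≤ e (*-monoˡ-≤ κ rate) ⟩
      a * suc p′ * κ + e              ≡⟨ regroup₂ a p′ κ e ⟩
      suc p′ * (a * κ) + e            ≡⟨ cong (λ x → suc p′ * x + e) e+k ⟨
      suc p′ * suc (e + k) + e        ≡⟨ regroup₃ p′ e k ⟩
      (2 + p′) * e + suc p′ * suc k   ∎)
    where
    open ≤-Reasoning
    regroup₁ : ∀ b₀ k p′ e → b₀ * suc (suc k * suc p′) + suc e + suc p′ * suc k ≡ suc b₀ * suc (suc k * suc p′) + e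
    regroup₁ = solve-∀
    regroup₂ : ∀ a p′ κ e → a * suc p′ * κ + e ≡ suc p′ * (a * κ) + e
    regroup₂ = solve-∀
    regroup₃ : ∀ p′ e k → suc p′ * suc (e + k) + e ≡ (2 + p′) * e + suc p′ * suc k
    regroup₃ = solve-∀
  -- The vertex count that cycle-mod-k requires is X * diameter + Y.
  s₁ s₂ h X Y M n₀ : ℕ
  s₁ = E * (p * b)
  s₂ = E * (2 + E * (p + p))
  h  = b * (k * suc b)
  X  = 2 * ((b + b * suc b) * (h * ((3 + 2 * b) * s₁ + 2)))
  Y  = 2 * ((b + b * suc b) * suc (h * ((3 + 2 * b) * s₂ + 2)))
  -- Twice `X * diameter` is 4Xq + 4X(1 + bM). As `M` exceeds 4X and qM ≤ n, the first term is at
  -- most n; `n₀` is the second term plus 2Y.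
  M  = suc (4 * X)
  n₀ = 2 * (2 * (X * suc (b * M)) + Y)
  found : (r : ℕ) → r < k → (n : ℕ) → n₀ ≤ n → (G : Graph n) → Expanding α G →
    Σ[ C ∈ Cycle G ] ∃[ m ] (cycleLength C ≡ m * k + r)
  found r r<k n n₀≤ G expanding = case Cycles.cycle-stable G k r (cycle-mod-k e (subst (λ e → Exp e ⊤) (sym e+k) (expand-ℕ G {a} {b₀} {κ} {α} 1≤b M q n<Mq convert expanding))
      1≤e ≤-refl rate-e (s≤s z≤n) (fromℕ< (≤-trans (s≤s z≤n) 2≤n)) enough r) of λ where
      (s , l , 3≤l , l≈r , path) → case Cycles.path⇒cycle G path 3≤l of λ where
        (C , C≡) → C , l / k , (begin
          cycleLength C         ≡⟨ C≡ ⟩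
          l                     ≡⟨ m≡m%n+[m/n]*n l k ⟩
          l % k + l / k * k     ≡⟨ cong (_+ l / k * k) (trans l≈r (m<n⇒m%n≡m r<k)) ⟩
          r + l / k * k         ≡⟨ +-comm r (l / k * k) ⟩
          l / k * k + r         ∎)
    where
    open ≡-Reasoning
    q = n / M
    n<Mq : n < M * suc q
    n<Mq = ≤-trans (s≤s (≤-reflexive (m≡m%n+[m/n]*n n M))) (≤-trans (+-monoˡ-≤ (q * M) (m%n<n n M))
      (≤-reflexive (*-comm (suc q) M)))
    open Expansion G b 1≤b M q n<Mq
    open Closing G b 1≤b M q n<Mq k′ 1≤k′
    requirement : ∀ b k p E d → let s = E * suc (suc (E * (p + p) + p * (b * d)))
                                    σ = (s + (2 + ((s + b * s) + (d + (s + b * s))))) + d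
                                    m = suc (b * (k * (σ + b * σ))) in
      2 * (b * m + b * (m + b * m)) ≡
        2 * ((b + b * suc b) * (b * (k * suc b) * ((3 + 2 * b) * (E * (p * b)) + 2))) * d
        + 2 * ((b + b * suc b) * suc (b * (k * suc b) * ((3 + 2 * b) * (E * (2 + E * (p + p))) + 2)))
    requirement = solve-∀
    X*d+Y≤n : X * diameter + Y ≤ n
    X*d+Y≤n = *-cancelˡ-≤ 2 (≤-trans (≤-reflexive (regroup X (b * M) q Y)) (≤-trans (+-mono-≤
      (≤-trans (*-monoʳ-≤ q (n≤1+n (4 * X))) (m/n*n≤m n M)) n₀≤) (≤-reflexive (cong (n +_) (sym (+-identityʳ n))))))
      where
      regroup : ∀ X c q Y → 2 * (X * ((suc q + c) + (suc q + c)) + Y) ≡ q * (4 * X) + 2 * (2 * (X * suc c) + Y)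
      regroup = solve-∀
    2≤n : 2 ≤ n
    2≤n = ≤-trans (*-monoʳ-≤ 2 {1} (*-mono-≤ (≤-trans 1≤b (m≤m+n b (b * suc b))) (s≤s z≤n))) (≤-trans (m≤n+m Y (X * diameter)) X*d+Y≤n)
    open Main p E 2≤n (unit-or-two k p (s≤s (s≤s z≤n)) least)
    enough : Small (suc (b * (k * Chains.Steps.lost G b 1≤b M q n<Mq k′ p E 2≤n (unit-or-two k p (s≤s (s≤s z≤n)) least))))
    enough = ≤-trans (≤-reflexive (requirement b k p E diameter)) X*d+Y≤n

theorem2 : (k : ℕ) → 1 < k →
    (p : ℕ) → Prime p → p ∣ k → (∀ q → Prime q → q ∣ k → p ≤ q) →
    (α : ℚ) → recipPred p <ℚ α →
    ∃[ n₀ ] ((r : ℕ) → r < k → (n : ℕ) → n₀ ≤ n → (G : Graph n) → Expanding α G →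
    Σ[ C ∈ Cycle G ] ∃[ m ] (cycleLength C ≡ m * k + r))
theorem2 k 1<k zero p-prime = ⊥-elim (¬prime[0] p-prime)
theorem2 k 1<k (suc zero) p-prime = ⊥-elim (¬prime[1] p-prime)
theorem2 k@(suc k′) (s≤s 1≤k′) p@(suc (suc p′)) p-prime p∣k least α α> = case rate-of p′ α α> of λ where
    (a , b₀ , 1≤b₀ , rate , convert) → large-expanders k′ 1≤k′ p′ least α a b₀ 1≤b₀ rate convert
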